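{- Let $G$ be a graph, let $k\geq 3$ be an integer and let $(T,\chi)$ be a $k$-atomic tree decomposition of $G$. Let $t\in V(T)$. If $u,v\in\chi(t)$ are non-adjacent vertices, each of degree at least $(2k-2)(k-2)$ in the torso $\hat\chi(t)$, then there are $k$ pairwise internally vertex-disjoint paths in $G$ from $u$ to $v$.
   Context: For a tree decomposition $(T,\chi)$ of $G$ and an edge $uv\in E(T)$, the adhesion at $uv$ is $\chi(u)\cap\chi(v)$; $adh(T,\chi)$ is $0$ if $E(T)=\emptyset$ and the maximum adhesion size over all edges of $T$ otherwise. The torso $\hat\chi(x)$ at $x\in V(T)$ is the graph obtained from $G[\chi(x)]$ by adding, for each $y\in N_T(x)$, an edge between every two non-adjacent vertices of $\chi(x)\cap\chi(y)$. For an $n$-vertex graph $G$, the fatness of a tree decomposition is the vector $(a_n,\dots,a_0)$, where $a_i$ is the number of bags of size $i$. A tree decomposition is $k$-atomic if its adhesion is less than $k$ and its fatness is lexicographically minimum among all tree decompositions of $G$ with adhesion less than $k$. -}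

module Defs where

open import Data.Nat using (ℕ; zero; suc; _+_; _*_; _∸_; _≤_; _<_; _⊔_)
open import Data.Nat.Properties using (_≟_)
open import Data.Bool using (Bool; true; false; _∧_; _∨_; not)
open import Data.Fin using (Fin)
import Data.Fin.Properties as FinP
open import Data.Fin.Subset using (Subset; _∩_; ∣_∣) renaming (_∈_ to _∈ₛ_)
open import Data.Fin.Subset.Properties using (_∈?_)
open import Data.Vec using (tabulate)
open import Data.List using (List; []; _∷_; length; map; foldr; downFrom; allFin; concatMap)
open import Data.List.Relation.Unary.All using (All)
open import Data.List.Relation.Unary.Unique.Propositional using (Unique)
open import Data.List.Membership.Propositional using () renaming (_∈_ to _∈ₗ_)
open import Data.Product using (Σ; ∃; _×_; _,_)
open import Data.Sum using (_⊎_)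
open import Data.Unit using (⊤)
open import Data.Empty using (⊥)
open import Relation.Nullary using (¬_)
open import Relation.Nullary.Decidable using (⌊_⌋)
open import Relation.Binary.PropositionalEquality using (_≡_; _≢_)

record Graph (n : ℕ) : Set where
  field
    adj    : Fin n → Fin n → Bool
    sym    : ∀ u v → adj u v ≡ adj v u
    irrefl : ∀ v → adj v v ≡ false
open Graph public

data Walk {n : ℕ} (G : Graph n) : Fin n → Fin n → List (Fin n) → Set where
  here : ∀ {u} → Walk G u u (u ∷ [])
  step : ∀ {u w v p} → adj G u w ≡ true → Walk G w v p → Walk G u v (u ∷ p)

Path : {n : ℕ} → Graph n → Fin n → Fin n → List (Fin n) → Set
Path G u v p = Walk G u v p × Unique p

Connected : {n : ℕ} → Graph n → Set
Connected {n} G = ∀ (x y : Fin n) → ∃ λ p → Walk G x y p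

HasCycle : {n : ℕ} → Graph n → Set
HasCycle {n} G = Σ (Fin n) λ x → Σ (Fin n) λ y → Σ (List (Fin n)) λ p →
  Path G x y p × 3 ≤ length p × adj G y x ≡ true

IsTree : {m : ℕ} → Graph m → Set
IsTree {m} T = 1 ≤ m × Connected T × ¬ HasCycle T

record TreeDecomp {n : ℕ} (G : Graph n) : Set where
  field
    m       : ℕ
    T       : Graph m
    isTree  : IsTree T
    χ       : Fin m → Subset n
    coverV  : ∀ (v : Fin n) → ∃ λ x → v ∈ₛ χ x
    coverE  : ∀ (u v : Fin n) → adj G u v ≡ true → ∃ λ x → u ∈ₛ χ x × v ∈ₛ χ x
    connV   : ∀ (v : Fin n) (x y : Fin m) → v ∈ₛ χ x → v ∈ₛ χ y →
                ∃ λ p → Walk T x y p × All (λ z → v ∈ₛ χ z) p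
open TreeDecomp public

pairs : (m : ℕ) → List (Fin m × Fin m)
pairs m = concatMap (λ x → map (λ y → (x , y)) (allFin m)) (allFin m)

adh : {n : ℕ} {G : Graph n} → TreeDecomp G → ℕ
adh D = foldr _⊔_ 0 (map f (pairs (m D)))
  where
    f : Fin (m D) × Fin (m D) → ℕ
    f (x , y) with adj (T D) x y
    ... | true  = ∣ χ D x ∩ χ D y ∣
    ... | false = 0

bagsOfSize : {n : ℕ} {G : Graph n} → TreeDecomp G → ℕ → ℕ
bagsOfSize D i = ∣ tabulate (λ x → ⌊ ∣ χ D x ∣ ≟ i ⌋) ∣

fatness : {n : ℕ} {G : Graph n} → TreeDecomp G → List ℕ
fatness {n} D = map (bagsOfSize D) (downFrom (suc n))

_≤lex_ : List ℕ → List ℕ → Set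
[] ≤lex _ = ⊤
(x ∷ xs) ≤lex [] = ⊥
(x ∷ xs) ≤lex (y ∷ ys) = x < y ⊎ (x ≡ y × xs ≤lex ys)

IsAtomic : {n : ℕ} {G : Graph n} → ℕ → TreeDecomp G → Set
IsAtomic {G = G} k D = adh D < k × (∀ (D' : TreeDecomp G) → adh D' < k → fatness D ≤lex fatness D')

-- adjacency in the torso at node t (a graph on χ(t), here on Fin n restricted to χ(t)):
-- u,v ∈ χ(t), u ≠ v, and either uv ∈ E(G) or u,v ∈ χ(t) ∩ χ(y) for some neighbour y of t.
torsoAdj : {n : ℕ} {G : Graph n} (D : TreeDecomp G) → Fin (m D) → Fin n → Fin n → Bool
torsoAdj {G = G} D t u v =
  ⌊ u ∈? χ D t ⌋ ∧ ⌊ v ∈? χ D t ⌋ ∧ not ⌊ FinP._≟_ u v ⌋ ∧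
  (adj G u v ∨ foldr _∨_ false
     (map (λ y → adj (T D) t y ∧ ⌊ u ∈? χ D y ⌋ ∧ ⌊ v ∈? χ D y ⌋) (allFin (m D))))

torsoDeg : {n : ℕ} {G : Graph n} (D : TreeDecomp G) → Fin (m D) → Fin n → ℕ
torsoDeg D t u = ∣ tabulate (λ w → torsoAdj D t u w) ∣

DisjointPaths : {n : ℕ} → Graph n → ℕ → Fin n → Fin n → Set
DisjointPaths {n} G k u v = Σ (Fin k → List (Fin n)) λ P →
  (∀ i → Path G u v (P i)) ×
  (∀ i j → i ≢ j → ∀ w → w ∈ₗ P i → w ∈ₗ P j → w ≡ u ⊎ w ≡ v)

{-# OPTIONS --safe #-}

-- Suppose fewer than k disjoint paths join u and v. By Menger there is a separation (A , B) of order less than k with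
-- u ∈ A \ B and v ∈ B \ A. Root T at t.
--
-- One of the sides, say A, has fewer than k vertices in χ(t). Otherwise choose (A , B) with at least k vertices of χ(t)
-- on both sides so that the separator X = A ∩ B is as close to t as possible (the sum over x ∈ X of the depth of the
-- topmost bag containing x is minimal), and take two copies of T joined at t. The bag at s becomes χ(s) ∩ A, respectively
-- χ(s) ∩ B, together with all x ∈ X whose bags lie below s. By minimality, whenever vertices are added to a bag
-- or an adhesion set, more are removed from it, so the fatness drops, contradicting atomicity.
--
-- A torso neighbour of u outside A shares with u an adhesion set χ(t) ∩ χ(s). The branch at s then contains a vertex of X
-- below t, for otherwise it could be split along (A , B), again decreasing the fatness. So there are at
-- most |X| < k such branches, each contributing at most k - 2 neighbours besides the at most k - 2 neighbours in A, and
-- the torso degree of u is at most k (k - 2) < (2k - 2)(k - 2).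
module Submission where

open import Defs renaming (sym to adj-sym)
open import Data.Bool using (Bool; true; false; _∧_; _∨_; not)
import Data.Bool.Properties as Boolₚ
import Data.Empty as Empty
open import Data.Empty using (⊥-elim)
open import Data.Fin using (Fin; zero; suc; _↑ˡ_; _↑ʳ_; splitAt; join)
open import Data.Fin.Properties
  using (_≟_; any?; suc-injective; 0≢1+n; splitAt-↑ˡ; splitAt-↑ʳ; join-splitAt; splitAt-join)
open import Data.Fin.Subset
open import Data.Fin.Subset.Properties
open import Data.List using (List; []; _∷_; map; foldr; filter; allFin; length; downFrom)
open import Data.List.Membership.Propositional using (lose) renaming (_∈_ to _∈ₗ_; _∉_ to _∉ₗ_)
open import Data.List.Membership.Propositional.Properties
  using (∈-concatMap⁺; ∈-map⁺; ∈-allFin; ∈-filter⁺; ∈-filter⁻)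
import Data.List.Membership.DecPropositional as DecMembership
open import Data.List.Properties using (map-cong)
open import Data.List.Relation.Unary.All as All using ([]; _∷_)
open import Data.List.Relation.Unary.All.Properties using (¬Any⇒All¬)
open import Data.List.Relation.Unary.AllPairs using ([]; _∷_)
open import Data.List.Relation.Unary.Any using (here; there)
open import Data.List.Relation.Unary.Unique.Propositional using (Unique)
open import Data.Nat using (ℕ; zero; suc; _+_; _*_; _∸_; _≤_; _<_; _⊔_; z≤n; s≤s; s≤s⁻¹)
open import Data.Nat.Induction using (<-wellFounded)
open import Data.Nat.Properties as ℕₚ hiding (_≟_; ≡-irrelevant; suc-injective; 0≢1+n)
open import Data.Product using (Σ; ∃; ∃₂; _×_; _,_; proj₁; proj₂)
open import Data.Sum using (_⊎_; inj₁; inj₂; [_,_]′; swap)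
open import Data.Vec using ([]; _∷_; tabulate; here; there)
open import Data.Vec.Properties using (lookup∘tabulate; lookup⇒[]=; []=⇒lookup; tabulate-cong)
open import Function using (_∘_; id)
open import Induction.WellFounded using (Acc; acc)
open import Relation.Binary.Definitions using (tri<; tri≈; tri>)
open import Relation.Binary.PropositionalEquality
open import Relation.Nullary using (¬_; Dec; yes; no; contradiction)
open import Relation.Nullary.Decidable
  using (⌊_⌋; isYes; isYes≗does; dec-true; decidable-stable; map′; toSum; ¬?; _×-dec_; _⊎-dec_; _→-dec_)
open import Relation.Unary using (Decidable)

-- Finite sets

compr : ∀ {n} {P : Fin n → Set} → Decidable P → Subset n
compr P? = tabulate (λ x → ⌊ P? x ⌋)

module _ {n : ℕ} {P : Fin n → Set} (P? : Decidable P) where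

  ∈-compr⁺ : ∀ {x} → P x → x ∈ compr P?
  ∈-compr⁺ {x} px = lookup⇒[]= x _ (trans (lookup∘tabulate _ x)
    (trans (isYes≗does (P? x)) (dec-true (P? x) px)))

  ∈-compr⁻ : ∀ {x} → x ∈ compr P? → P x
  ∈-compr⁻ {x} x∈ with P? x | trans (sym (lookup∘tabulate (λ y → ⌊ P? y ⌋) x)) ([]=⇒lookup x∈)
  ... | yes px | _ = px
  ... | no _ | ()

x∈p─q⁻ : ∀ {n} {x : Fin n} (p q : Subset n) → x ∈ p ─ q → x ∈ p × x ∉ q
x∈p─q⁻ (s ∷ p) (true ∷ q) (there x∈) = there (proj₁ ih) , λ { (there h) → proj₂ ih h }
  where ih = x∈p─q⁻ p q x∈
x∈p─q⁻ (s ∷ p) (false ∷ q) here = here , λ ()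
x∈p─q⁻ (s ∷ p) (false ∷ q) (there x∈) = there (proj₁ ih) , λ { (there h) → proj₂ ih h }
  where ih = x∈p─q⁻ p q x∈

∣p∪q∣≤∣p∣+∣q∣ : ∀ {n} (p q : Subset n) → ∣ p ∪ q ∣ ≤ ∣ p ∣ + ∣ q ∣
∣p∪q∣≤∣p∣+∣q∣ [] [] = z≤n
∣p∪q∣≤∣p∣+∣q∣ (true ∷ p) (true ∷ q) = s≤s (≤-trans (∣p∪q∣≤∣p∣+∣q∣ p q) (+-monoʳ-≤ ∣ p ∣ (n≤1+n _)))
∣p∪q∣≤∣p∣+∣q∣ (true ∷ p) (false ∷ q) = s≤s (∣p∪q∣≤∣p∣+∣q∣ p q)
∣p∪q∣≤∣p∣+∣q∣ (false ∷ p) (true ∷ q) = ≤-trans (s≤s (∣p∪q∣≤∣p∣+∣q∣ p q)) (≤-reflexive (sym (+-suc ∣ p ∣ ∣ q ∣)))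
∣p∪q∣≤∣p∣+∣q∣ (false ∷ p) (false ∷ q) = ∣p∪q∣≤∣p∣+∣q∣ p q

∣p∣≡∣p∩q∣+∣p─q∣ : ∀ {n} (p q : Subset n) → ∣ p ∣ ≡ ∣ p ∩ q ∣ + ∣ p ─ q ∣
∣p∣≡∣p∩q∣+∣p─q∣ [] [] = refl
∣p∣≡∣p∩q∣+∣p─q∣ (true ∷ p) (true ∷ q) = cong suc (∣p∣≡∣p∩q∣+∣p─q∣ p q)
∣p∣≡∣p∩q∣+∣p─q∣ (true ∷ p) (false ∷ q) = trans (cong suc (∣p∣≡∣p∩q∣+∣p─q∣ p q)) (sym (+-suc _ _))
∣p∣≡∣p∩q∣+∣p─q∣ (false ∷ p) (true ∷ q) = ∣p∣≡∣p∩q∣+∣p─q∣ p q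
∣p∣≡∣p∩q∣+∣p─q∣ (false ∷ p) (false ∷ q) = ∣p∣≡∣p∩q∣+∣p─q∣ p q

disjoint⇒∣p∣+∣q∣≤∣p∪q∣ : ∀ {n} (p q : Subset n) → (∀ {x} → x ∈ p → x ∉ q) → ∣ p ∣ + ∣ q ∣ ≤ ∣ p ∪ q ∣
disjoint⇒∣p∣+∣q∣≤∣p∪q∣ [] [] _ = z≤n
disjoint⇒∣p∣+∣q∣≤∣p∪q∣ (true ∷ p) (true ∷ q) dis = ⊥-elim (dis here here)
disjoint⇒∣p∣+∣q∣≤∣p∪q∣ (true ∷ p) (false ∷ q) dis = s≤s (disjoint⇒∣p∣+∣q∣≤∣p∪q∣ p q λ a b → dis (there a) (there b))
disjoint⇒∣p∣+∣q∣≤∣p∪q∣ (false ∷ p) (true ∷ q) dis =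
  ≤-trans (≤-reflexive (+-suc ∣ p ∣ ∣ q ∣)) (s≤s (disjoint⇒∣p∣+∣q∣≤∣p∪q∣ p q λ a b → dis (there a) (there b)))
disjoint⇒∣p∣+∣q∣≤∣p∪q∣ (false ∷ p) (false ∷ q) dis = disjoint⇒∣p∣+∣q∣≤∣p∪q∣ p q λ a b → dis (there a) (there b)

⊆∪⇒∣p∣≤ : ∀ {n} {p q r : Subset n} → (∀ {x} → x ∈ p → x ∈ q ⊎ x ∈ r) → ∣ p ∣ ≤ ∣ q ∣ + ∣ r ∣
⊆∪⇒∣p∣≤ {q = q} {r} p⊆ = ≤-trans (p⊆q⇒∣p∣≤∣q∣ (x∈p∪q⁺ ∘ p⊆)) (∣p∪q∣≤∣p∣+∣q∣ q r)

∣p∣≤1+∣p-x∣ : ∀ {n} (p : Subset n) x → ∣ p ∣ ≤ suc ∣ p - x ∣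
∣p∣≤1+∣p-x∣ p x = ≤-trans (≤-reflexive (∣p∣≡∣p∩q∣+∣p─q∣ p ⁅ x ⁆))
  (+-monoˡ-≤ _ (≤-trans (∣p∩q∣≤∣q∣ p ⁅ x ⁆) (≤-reflexive (∣⁅x⁆∣≡1 x))))

x∈p-y⁻ : ∀ {n} (p : Subset n) {x y} → x ∈ p - y → x ∈ p × x ≢ y
x∈p-y⁻ p {x} {y} x∈ = let x∈p , x∉ = x∈p─q⁻ p ⁅ y ⁆ x∈ in x∈p , x∉⁅y⁆⇒x≢y x∉

p⊆q∧x⇒∣p∣<∣q∣ : ∀ {n} {p q : Subset n} {x} → p ⊆ q → x ∈ q → x ∉ p → ∣ p ∣ < ∣ q ∣
p⊆q∧x⇒∣p∣<∣q∣ p⊆q x∈q x∉p = p⊂q⇒∣p∣<∣q∣ (p⊆q , _ , x∈q , x∉p)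

∣compr∣-++ : ∀ m {n} {P : Fin (m + n) → Set} (P? : Decidable P) →
  ∣ compr P? ∣ ≡ ∣ compr (P? ∘ (_↑ˡ n)) ∣ + ∣ compr (P? ∘ (m ↑ʳ_)) ∣
∣compr∣-++ zero P? = refl
∣compr∣-++ (suc m) P? with ⌊ P? zero ⌋ | ∣compr∣-++ m (P? ∘ suc)
... | true  | ih = cong suc ih
... | false | ih = ih

injection⇒k≤∣p∣ : ∀ {k n} (p : Subset n) (f : Fin k → Fin n) →
  (∀ {i j} → f i ≡ f j → i ≡ j) → (∀ i → f i ∈ p) → k ≤ ∣ p ∣
injection⇒k≤∣p∣ {zero} p f inj f∈ = z≤n
injection⇒k≤∣p∣ {suc k} p f inj f∈ = ≤-<-trans
  (injection⇒k≤∣p∣ (p - f zero) (f ∘ suc) (suc-injective ∘ inj)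
    (λ i → x∈p∧x≢y⇒x∈p-y (f∈ (suc i)) (λ e → contradiction (inj (sym e)) 0≢1+n)))
  (x∈p⇒∣p-x∣<∣p∣ (f∈ zero))

-- Pigeonhole: if `x` were missed, `f` would inject `Fin k` into `p - x`, which has fewer than `k`
-- elements.
injection⇒surjection : ∀ {k n} (p : Subset n) (f : Fin k → Fin n) →
  (∀ {i j} → f i ≡ f j → i ≡ j) → (∀ i → f i ∈ p) → ∣ p ∣ ≤ k → ∀ {x} → x ∈ p → ∃ λ i → f i ≡ x
injection⇒surjection p f inj f∈ ∣p∣≤k {x} x∈ with any? (λ i → f i ≟ x)
... | yes h = h
... | no ¬h = ⊥-elim (<⇒≱ (x∈p⇒∣p-x∣<∣p∣ x∈) (≤-trans ∣p∣≤k
  (injection⇒k≤∣p∣ (p - x) f inj (λ i → x∈p∧x≢y⇒x∈p-y (f∈ i) (λ e → ¬h (i , e))))))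

k≤∣p∣⇒injection : ∀ k {n} (p : Subset n) → k ≤ ∣ p ∣ →
  Σ (Fin k → Fin n) λ f → (∀ {i j} → f i ≡ f j → i ≡ j) × (∀ i → f i ∈ p)
k≤∣p∣⇒injection zero p _ = (λ ()) , (λ { {()} }) , λ ()
k≤∣p∣⇒injection (suc k) {n} p k<∣p∣ with nonempty? p
... | no ¬ne = ⊥-elim (<⇒≱ k<∣p∣ (≤-trans (≤-reflexive (trans (cong ∣_∣ (Empty-unique ¬ne)) (∣⊥∣≡0 n))) z≤n))
... | yes (x , x∈p) with k≤∣p∣⇒injection k (p - x) (s≤s⁻¹ (≤-trans k<∣p∣ (∣p∣≤1+∣p-x∣ p x)))
... | f , inj , f∈ = g , g-inj , g∈
  where
  g : Fin (suc k) → Fin n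
  g zero = x
  g (suc i) = f i
  g-inj : ∀ {i j} → g i ≡ g j → i ≡ j
  g-inj {zero} {zero} _ = refl
  g-inj {zero} {suc j} e = ⊥-elim (proj₂ (x∈p-y⁻ p (f∈ j)) (sym e))
  g-inj {suc i} {zero} e = ⊥-elim (proj₂ (x∈p-y⁻ p (f∈ i)) e)
  g-inj {suc i} {suc j} e = cong suc (inj e)
  g∈ : ∀ i → g i ∈ p
  g∈ zero = x∈p
  g∈ (suc i) = proj₁ (x∈p-y⁻ p (f∈ i))

bigUnion : ∀ {k n} → Subset k → (Fin k → Subset n) → Subset n
bigUnion [] W = ⊥
bigUnion (true ∷ p) W = W zero ∪ bigUnion p (W ∘ suc)
bigUnion (false ∷ p) W = bigUnion p (W ∘ suc)

∈-bigUnion⁺ : ∀ {k n} {p : Subset k} (W : Fin k → Subset n) {i x} → i ∈ p → x ∈ W i → x ∈ bigUnion p W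
∈-bigUnion⁺ {p = true ∷ p} W here x∈ = x∈p∪q⁺ (inj₁ x∈)
∈-bigUnion⁺ {p = true ∷ p} W (there i∈) x∈ = x∈p∪q⁺ (inj₂ (∈-bigUnion⁺ (W ∘ suc) i∈ x∈))
∈-bigUnion⁺ {p = false ∷ p} W (there i∈) x∈ = ∈-bigUnion⁺ (W ∘ suc) i∈ x∈

∣bigUnion∣≤ : ∀ {k n c} (p : Subset k) (W : Fin k → Subset n) → (∀ i → ∣ W i ∣ ≤ c) → ∣ bigUnion p W ∣ ≤ ∣ p ∣ * c
∣bigUnion∣≤ {n = n} [] W W≤ = ≤-reflexive (∣⊥∣≡0 n)
∣bigUnion∣≤ (true ∷ p) W W≤ = ≤-trans (∣p∪q∣≤∣p∣+∣q∣ (W zero) _) (+-mono-≤ (W≤ zero) (∣bigUnion∣≤ p (W ∘ suc) (W≤ ∘ suc)))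
∣bigUnion∣≤ (false ∷ p) W W≤ = ∣bigUnion∣≤ p (W ∘ suc) (W≤ ∘ suc)

-- Weighted sizes of finite sets

weight : ∀ {n} → (Fin n → ℕ) → Subset n → ℕ
weight d [] = 0
weight d (true ∷ p) = d zero + weight (d ∘ suc) p
weight d (false ∷ p) = weight (d ∘ suc) p

weight-∪ : ∀ {n} (d : Fin n → ℕ) {p q r : Subset n} → (∀ {x} → x ∈ p → x ∈ q ⊎ x ∈ r) →
  weight d p ≤ weight d q + weight d r
weight-∪ d {[]} {[]} {[]} p⊆ = z≤n
weight-∪ d {true ∷ p} {true ∷ q} {r₀ ∷ r} p⊆ = ≤-trans
  (+-monoʳ-≤ (d zero) (weight-∪ (d ∘ suc) {p} {q} {r} (λ x∈ → [ inj₁ ∘ drop-there , inj₂ ∘ drop-there ]′ (p⊆ (there x∈)))))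
  (≤-trans (≤-reflexive (sym (+-assoc (d zero) _ _))) (+-monoʳ-≤ (d zero + weight (d ∘ suc) q) (tail≤ r₀)))
  where
  tail≤ : ∀ b → weight (d ∘ suc) r ≤ weight d (b ∷ r)
  tail≤ true = m≤n+m _ _
  tail≤ false = ≤-refl
weight-∪ d {true ∷ p} {false ∷ q} {true ∷ r} p⊆ = ≤-trans
  (+-monoʳ-≤ (d zero) (weight-∪ (d ∘ suc) {p} {q} {r} (λ x∈ → [ inj₁ ∘ drop-there , inj₂ ∘ drop-there ]′ (p⊆ (there x∈)))))
  (≤-reflexive (trans (sym (+-assoc (d zero) _ _)) (trans (cong (_+ weight (d ∘ suc) r) (+-comm (d zero) _)) (+-assoc (weight (d ∘ suc) q) _ _))))
weight-∪ d {true ∷ p} {false ∷ q} {false ∷ r} p⊆ = [ (λ ()) , (λ ()) ]′ (p⊆ here)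
weight-∪ d {false ∷ p} {q₀ ∷ q} {r₀ ∷ r} p⊆ = ≤-trans
  (weight-∪ (d ∘ suc) {p} {q} {r} (λ x∈ → [ inj₁ ∘ drop-there , inj₂ ∘ drop-there ]′ (p⊆ (there x∈))))
  (+-mono-≤ (tail≤ q₀ q) (tail≤ r₀ r))
  where
  tail≤ : ∀ b s → weight (d ∘ suc) s ≤ weight d (b ∷ s)
  tail≤ true s = m≤n+m _ _
  tail≤ false s = ≤-refl

weight-∩-─ : ∀ {n} (d : Fin n → ℕ) (p q : Subset n) → weight d p ≡ weight d (p ∩ q) + weight d (p ─ q)
weight-∩-─ d [] [] = refl
weight-∩-─ d (true ∷ p) (true ∷ q) = trans (cong (d zero +_) (weight-∩-─ (d ∘ suc) p q)) (sym (+-assoc (d zero) _ _))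
weight-∩-─ d (true ∷ p) (false ∷ q) = trans (cong (d zero +_) (weight-∩-─ (d ∘ suc) p q))
  (trans (sym (+-assoc (d zero) _ _)) (trans (cong (_+ weight (d ∘ suc) (p ─ q)) (+-comm (d zero) _)) (+-assoc (weight (d ∘ suc) (p ∩ q)) _ _)))
weight-∩-─ d (false ∷ p) (true ∷ q) = weight-∩-─ (d ∘ suc) p q
weight-∩-─ d (false ∷ p) (false ∷ q) = weight-∩-─ (d ∘ suc) p q

weight≤∣p∣*c : ∀ {n c} (d : Fin n → ℕ) (p : Subset n) → (∀ {x} → x ∈ p → d x ≤ c) → weight d p ≤ ∣ p ∣ * c
weight≤∣p∣*c d [] d≤ = z≤n
weight≤∣p∣*c d (true ∷ p) d≤ = +-mono-≤ (d≤ here) (weight≤∣p∣*c (d ∘ suc) p (d≤ ∘ there))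
weight≤∣p∣*c d (false ∷ p) d≤ = weight≤∣p∣*c (d ∘ suc) p (d≤ ∘ there)

∣p∣*c≤weight : ∀ {n c} (d : Fin n → ℕ) (p : Subset n) → (∀ {x} → x ∈ p → c ≤ d x) → ∣ p ∣ * c ≤ weight d p
∣p∣*c≤weight d [] c≤ = z≤n
∣p∣*c≤weight d (true ∷ p) c≤ = +-mono-≤ (c≤ here) (∣p∣*c≤weight (d ∘ suc) p (c≤ ∘ there))
∣p∣*c≤weight d (false ∷ p) c≤ = ∣p∣*c≤weight (d ∘ suc) p (c≤ ∘ there)

x∈p⇒0<∣p∣ : ∀ {n} {p : Subset n} {x} → x ∈ p → 0 < ∣ p ∣
x∈p⇒0<∣p∣ x∈p = ≤-<-trans z≤n (x∈p⇒∣p-x∣<∣p∣ x∈p)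

-- The elements of `r` removed from `q` weigh at least `c + 1` each; those of `s` that replace them
-- are at most as many and weigh at most `c` each. The loss is strict because `q ∩ r` is nonempty.
weight-exchange : ∀ {n c} (d : Fin n → ℕ) {p q r s : Subset n} →
  (∀ {x} → x ∈ p → x ∈ q ─ r ⊎ x ∈ s) → ∣ s ∣ ≤ ∣ q ∩ r ∣ → Nonempty (q ∩ r) →
  (∀ {x} → x ∈ s → d x ≤ c) → (∀ {x} → x ∈ r → c < d x) → weight d p < weight d q
weight-exchange {c = c} d {p} {q} {r} {s} p⊆ ∣s∣≤ (x , x∈) s≤ r> = begin-strict
  weight d p                          ≤⟨ weight-∪ d p⊆ ⟩
  weight d (q ─ r) + weight d s       ≤⟨ +-monoʳ-≤ _ (weight≤∣p∣*c d s s≤) ⟩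
  weight d (q ─ r) + ∣ s ∣ * c         ≤⟨ +-monoʳ-≤ _ (*-monoˡ-≤ c ∣s∣≤) ⟩
  weight d (q ─ r) + ∣ q ∩ r ∣ * c     <⟨ +-monoʳ-< (weight d (q ─ r)) (m<n+m (∣ q ∩ r ∣ * c) (x∈p⇒0<∣p∣ x∈)) ⟩
  weight d (q ─ r) + (∣ q ∩ r ∣ + ∣ q ∩ r ∣ * c) ≡⟨ cong (weight d (q ─ r) +_) (sym (*-suc ∣ q ∩ r ∣ c)) ⟩
  weight d (q ─ r) + ∣ q ∩ r ∣ * suc c ≤⟨ +-monoʳ-≤ _ (∣p∣*c≤weight d (q ∩ r) (λ x∈ → r> (proj₂ (x∈p∩q⁻ q r x∈)))) ⟩
  weight d (q ─ r) + weight d (q ∩ r) ≡⟨ +-comm (weight d (q ─ r)) _ ⟩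
  weight d (q ∩ r) + weight d (q ─ r) ≡⟨ weight-∩-─ d q r ⟨
  weight d q                          ∎
  where open ≤-Reasoning

-- Chains and Menger’s theorem

-- Walks along an arbitrary relation, so that Menger's theorem can be proved for directed arcs and
-- then transferred to graphs.
data Chain {N : Set} (R : N → N → Set) : N → N → List N → Set where
  stop : ∀ {u} → Chain R u u (u ∷ [])
  _◅_  : ∀ {u w v p} → R u w → Chain R w v p → Chain R u v (u ∷ p)

infixr 5 _◅_

module _ {N : Set} {R : N → N → Set} where

  chain-start : ∀ {u v p} → Chain R u v p → u ∈ₗ p
  chain-start stop = here refl
  chain-start (_ ◅ _) = here refl

  chain-end : ∀ {u v p} → Chain R u v p → v ∈ₗ p
  chain-end stop = here refl
  chain-end (_ ◅ c) = there (chain-end c)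

  chain-++ : ∀ {u w v p q} → Chain R u w p → Chain R w v q →
    ∃ λ r → Chain R u v r × (∀ {z} → z ∈ₗ r → z ∈ₗ p ⊎ z ∈ₗ q)
  chain-++ stop d = _ , d , inj₂
  chain-++ (e ◅ c) d with chain-++ c d
  ... | r , cd , r⊆ = _ , e ◅ cd , λ { (here z≡) → inj₁ (here z≡) ; (there z∈) → [ inj₁ ∘ there , inj₂ ]′ (r⊆ z∈) }

  chain-reverse : (∀ {x y} → R x y → R y x) → ∀ {u v p} → Chain R u v p →
    ∃ λ q → Chain R v u q × (∀ {z} → z ∈ₗ q → z ∈ₗ p)
  chain-reverse R-sym stop = _ , stop , id
  chain-reverse R-sym (e ◅ c) with chain-reverse R-sym c
  ... | q , c′ , q⊆ with chain-++ c′ (R-sym e ◅ stop)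
  ... | r , d , r⊆ = r , d , λ z∈ → case-r (r⊆ z∈)
    where
    case-r : ∀ {z} → z ∈ₗ q ⊎ z ∈ₗ _ → z ∈ₗ _
    case-r (inj₁ z∈) = there (q⊆ z∈)
    case-r (inj₂ (here refl)) = there (chain-start c)
    case-r (inj₂ (there (here refl))) = here refl

  chain-suffix : ∀ {u w v p} → Chain R u v p → Unique p → w ∈ₗ p →
    ∃ λ q → Chain R w v q × Unique q × (∀ {z} → z ∈ₗ q → z ∈ₗ p)
  chain-suffix c uq (here refl) = aux c uq
    where
    aux : ∀ {u v w p} → Chain R u v (w ∷ p) → Unique (w ∷ p) →
      ∃ λ q → Chain R w v q × Unique q × (∀ {z} → z ∈ₗ q → z ∈ₗ w ∷ p)
    aux stop uq = _ , stop , uq , id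
    aux (e ◅ c) uq = _ , (e ◅ c) , uq , id
  chain-suffix (e ◅ c) (_ ∷ uq) (there w∈) with chain-suffix c uq w∈
  ... | q , d , uq′ , q⊆ = q , d , uq′ , there ∘ q⊆

chain-map : ∀ {N : Set} {R S : N → N → Set} → (∀ {x y} → R x y → S x y) →
  ∀ {u v p} → Chain R u v p → Chain S u v p
chain-map f stop = stop
chain-map f (e ◅ c) = f e ◅ chain-map f c

module _ {n : ℕ} {R : Fin n → Fin n → Set} where
  open DecMembership (_≟_ {n}) using () renaming (_∈?_ to _∈ₗ?_)

  -- Loop erasure: when the start occurs again in the erased remainder, everything before that
  -- occurrence is cut off.
  chain-erase : ∀ {u v p} → Chain R u v p →
    ∃ λ q → Chain R u v q × Unique q × (∀ {z} → z ∈ₗ q → z ∈ₗ p)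
  chain-erase stop = _ , stop , [] ∷ [] , id
  chain-erase {u} (e ◅ c) with chain-erase c
  ... | q , d , uq , q⊆ with u ∈ₗ? q
  ... | yes u∈q = let r , d′ , uq′ , r⊆ = chain-suffix d uq u∈q in r , d′ , uq′ , there ∘ q⊆ ∘ r⊆
  ... | no u∉q = u ∷ q , e ◅ d , ¬Any⇒All¬ q u∉q ∷ uq ,
    λ { (here z≡) → here z≡ ; (there z∈) → there (q⊆ z∈) }

-- A path may consist of a single vertex of `A ∩ B`, and its interior may pass through `A` and `B`.
record Linkage {n : ℕ} (R : Fin n → Fin n → Set) (A B : Subset n) (k : ℕ) : Set where
  field
    src tgt  : Fin k → Fin n
    path     : Fin k → List (Fin n)
    chain    : ∀ i → Chain R (src i) (tgt i) (path i)
    unique   : ∀ i → Unique (path i)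
    src∈     : ∀ i → src i ∈ A
    tgt∈     : ∀ i → tgt i ∈ B
    disjoint : ∀ {i j z} → z ∈ₗ path i → z ∈ₗ path j → i ≡ j

  src∈path : ∀ i → src i ∈ₗ path i
  src∈path i = chain-start (chain i)

  tgt∈path : ∀ i → tgt i ∈ₗ path i
  tgt∈path i = chain-end (chain i)

  module _ (∣B∣≤k : ∣ B ∣ ≤ k) where
    tgt-surjective : ∀ {z} → z ∈ B → ∃ λ i → tgt i ≡ z
    tgt-surjective = injection⇒surjection B tgt
      (λ {i} {j} e → disjoint (tgt∈path i) (subst (_∈ₗ path j) (sym e) (tgt∈path j))) tgt∈ ∣B∣≤k

    -- With at most `k` vertices in `B`, the `k` distinct ends exhaust `B`, so by disjointness a
    -- path meets `B` in its own end only.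
    only-tgt : ∀ {i z} → z ∈ₗ path i → z ∈ B → z ≡ tgt i
    only-tgt z∈ z∈B with tgt-surjective z∈B
    ... | j , refl = cong tgt (disjoint (tgt∈path j) z∈)

  module _ (∣A∣≤k : ∣ A ∣ ≤ k) where
    src-surjective : ∀ {z} → z ∈ A → ∃ λ i → src i ≡ z
    src-surjective = injection⇒surjection A src
      (λ {i} {j} e → disjoint (src∈path i) (subst (_∈ₗ path j) (sym e) (src∈path j))) src∈ ∣A∣≤k

    only-src : ∀ {i z} → z ∈ₗ path i → z ∈ A → z ≡ src i
    only-src z∈ z∈A with src-surjective z∈A
    ... | j , refl = cong src (disjoint (src∈path j) z∈)

linkage-map : ∀ {n} {R S : Fin n → Fin n → Set} {A B k} → (∀ {x y} → R x y → S x y) →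
  Linkage R A B k → Linkage S A B k
linkage-map f ℓ = record
  { src = src ; tgt = tgt ; path = path ; chain = chain-map f ∘ chain ; unique = unique
  ; src∈ = src∈ ; tgt∈ = tgt∈ ; disjoint = disjoint }
  where open Linkage ℓ

-- Directed: only arcs from outside `right` to outside `left` are excluded. For a symmetric relation
-- this is the usual notion of a separation.
record Separation {n : ℕ} (R : Fin n → Fin n → Set) : Set where
  field
    left right : Subset n
    cover      : ∀ v → v ∈ left ⊎ v ∈ right
    no-cross   : ∀ {x y} → R x y → x ∈ right ⊎ y ∈ left

  separator : Subset n
  separator = left ∩ right

open Separation

Separates : ∀ {n} {R : Fin n → Fin n → Set} → Separation R → Subset n → Subset n → ℕ → Set
Separates s A B k = A ⊆ left s × B ⊆ right s × ∣ separator s ∣ < k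

module _ {n : ℕ} {R : Fin n → Fin n → Set} (s : Separation R) where

  -- The left side can be left only along an arc whose tail lies in the separator. That tail would
  -- be the end `b`, yet `b` occurs again later on the repetition-free chain.
  chain-stays-left : ∀ {a b p} → Chain R a b p → Unique p → a ∈ left s →
    (∀ {z} → z ∈ₗ p → z ∈ separator s → z ≡ b) → ∀ {z} → z ∈ₗ p → z ∈ left s
  chain-stays-left stop uq a∈ only (here refl) = a∈
  chain-stays-left (e ◅ c) uq a∈ only (here refl) = a∈
  chain-stays-left (e ◅ c) (a≢ ∷ uq) a∈ only (there z∈) with no-cross s e
  ... | inj₁ a∈r = ⊥-elim (All.lookup a≢ (chain-end c) (only (here refl) (x∈p∩q⁺ (a∈ , a∈r))))
  ... | inj₂ w∈l = chain-stays-left c uq w∈l (only ∘ there) z∈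

  -- Argued backwards from the end: an arc entering the right side from outside has its head in the
  -- separator, which every vertex after the first avoids.
  chain-stays-right : ∀ {a b p} → Chain R a b (a ∷ p) → b ∈ right s →
    (∀ {z} → z ∈ₗ p → z ∉ separator s) → ∀ {z} → z ∈ₗ a ∷ p → z ∈ right s
  chain-stays-right stop b∈ avoid (here refl) = b∈
  chain-stays-right (e ◅ stop) b∈ avoid (there (here refl)) = b∈
  chain-stays-right (e ◅ c@(_ ◅ _)) b∈ avoid (there z∈) = chain-stays-right c b∈ (avoid ∘ there) z∈
  chain-stays-right (e ◅ stop) b∈ avoid (here refl) with no-cross s e
  ... | inj₁ a∈r = a∈r
  ... | inj₂ w∈l = ⊥-elim (avoid (here refl) (x∈p∩q⁺ (w∈l , b∈)))
  chain-stays-right (e ◅ c@(_ ◅ _)) b∈ avoid (here refl) with no-cross s e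
  ... | inj₁ a∈r = a∈r
  ... | inj₂ w∈l = ⊥-elim (avoid (here refl) (x∈p∩q⁺ (w∈l , chain-stays-right c b∈ (avoid ∘ there) (here refl))))

Arc : ∀ {n} → List (Fin n × Fin n) → Fin n → Fin n → Set
Arc L x y = (x , y) ∈ₗ L

module Combine {n k : ℕ} {L : List (Fin n × Fin n)} {A B : Subset n} {x y : Fin n}
  (s : Separation (Arc L)) (A⊆ : A ⊆ left s) (B⊆ : B ⊆ right s) (∣s∣<k : ∣ separator s ∣ < k)
  (x∈left : x ∈ left s) (y∈right : y ∈ right s) (y∉left : y ∉ left s)
  (ℓ₁ : Linkage (Arc L) A (separator s ∪ ⁅ x ⁆) k) (ℓ₂ : Linkage (Arc L) (separator s ∪ ⁅ y ⁆) B k) where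

  private
    module ℓ₁ = Linkage ℓ₁
    module ℓ₂ = Linkage ℓ₂

    ∣S∪⁅_⁆∣≤k : ∀ z → ∣ separator s ∪ ⁅ z ⁆ ∣ ≤ k
    ∣S∪⁅ z ⁆∣≤k = ≤-trans (∣p∪q∣≤∣p∣+∣q∣ (separator s) ⁅ z ⁆)
      (≤-trans (≤-reflexive (trans (cong (∣ separator s ∣ +_) (∣⁅x⁆∣≡1 z)) (+-comm _ 1))) ∣s∣<k)

    -- A path of `ℓ₁` ending in the separator goes on as the path of `ℓ₂` that starts there; one
    -- ending in `x` takes the arc from `x` to `y`.
    Linked : Fin k → Fin k → Set
    Linked i j = ℓ₁.tgt i ≡ ℓ₂.src j ⊎ (ℓ₁.tgt i ≡ x × ℓ₂.src j ≡ y)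

    linked : ∀ i → ∃ (Linked i)
    linked i with x∈p∪q⁻ (separator s) ⁅ x ⁆ (ℓ₁.tgt∈ i)
    ... | inj₁ ∈S = let j , e = ℓ₂.src-surjective ∣S∪⁅ y ⁆∣≤k (x∈p∪q⁺ (inj₁ ∈S)) in j , inj₁ (sym e)
    ... | inj₂ ∈x = let j , e = ℓ₂.src-surjective ∣S∪⁅ y ⁆∣≤k (x∈p∪q⁺ (inj₂ (x∈⁅x⁆ y)))
                    in j , inj₂ (x∈⁅y⁆⇒x≡y x ∈x , e)

    next : Fin k → Fin k
    next i = proj₁ (linked i)

    path₁⊆left : ∀ i {z} → z ∈ₗ ℓ₁.path i → z ∈ left s
    path₁⊆left i = chain-stays-left s (ℓ₁.chain i) (ℓ₁.unique i) (A⊆ (ℓ₁.src∈ i))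
      (λ z∈ z∈S → ℓ₁.only-tgt ∣S∪⁅ x ⁆∣≤k z∈ (x∈p∪q⁺ (inj₁ z∈S)))

    path₂⊆right : ∀ i {z} → z ∈ₗ ℓ₂.path i → z ∈ right s
    path₂⊆right i = aux (ℓ₂.chain i) (ℓ₂.unique i) (B⊆ (ℓ₂.tgt∈ i))
      (λ z∈ z∈S → ℓ₂.only-src ∣S∪⁅ y ⁆∣≤k z∈ (x∈p∪q⁺ (inj₁ z∈S)))
      where
      aux : ∀ {a b p} → Chain (Arc L) a b p → Unique p → b ∈ right s →
        (∀ {z} → z ∈ₗ p → z ∈ separator s → z ≡ a) → ∀ {z} → z ∈ₗ p → z ∈ right s
      aux stop uq b∈ only = chain-stays-right s stop b∈ (λ ())
      aux (e ◅ c) (a≢ ∷ uq) b∈ only = chain-stays-right s (e ◅ c) b∈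
        (λ z∈ z∈S → All.lookup a≢ z∈ (sym (only (there z∈) z∈S)))

    tgt₁≢y : ∀ i → ℓ₁.tgt i ≢ y
    tgt₁≢y i e = y∉left (subst (_∈ left s) e (path₁⊆left i (ℓ₁.tgt∈path i)))

    same-tgt : ∀ {i j} → ℓ₁.tgt i ≡ ℓ₁.tgt j → i ≡ j
    same-tgt {i} {j} e = ℓ₁.disjoint (ℓ₁.tgt∈path i) (subst (_∈ₗ ℓ₁.path j) (sym e) (ℓ₁.tgt∈path j))

    -- The paths of `ℓ₁` stay in `left s`, so none ends at `y`; hence a path of `ℓ₂` cannot have
    -- predecessors of both kinds.
    common-next : ∀ {i i′ j} → Linked i j → Linked i′ j → i ≡ i′
    common-next (inj₁ e) (inj₁ e′) = same-tgt (trans e (sym e′))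
    common-next {i} (inj₁ e) (inj₂ (_ , e′)) = ⊥-elim (tgt₁≢y i (trans e e′))
    common-next {i′ = i′} (inj₂ (_ , e)) (inj₁ e′) = ⊥-elim (tgt₁≢y i′ (trans e′ e))
    common-next (inj₂ (e , _)) (inj₂ (e′ , _)) = same-tgt (trans e (sym e′))

    -- A common vertex lies on both sides, hence in the separator, so it is the end of the first
    -- path and the start of the second.
    meet : ∀ {i i′ z} → z ∈ₗ ℓ₁.path i → z ∈ₗ ℓ₂.path (next i′) → i ≡ i′
    meet {i} {i′} z∈₁ z∈₂ = common-next (inj₁ tgt≡src) (proj₂ (linked i′))
      where
      z∈S = x∈p∩q⁺ (path₁⊆left i z∈₁ , path₂⊆right (next i′) z∈₂)
      tgt≡src = trans (sym (ℓ₁.only-tgt ∣S∪⁅ x ⁆∣≤k z∈₁ (x∈p∪q⁺ (inj₁ z∈S))))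
                      (ℓ₂.only-src ∣S∪⁅ y ⁆∣≤k z∈₂ (x∈p∪q⁺ (inj₁ z∈S)))

    R : Fin n → Fin n → Set
    R = Arc ((x , y) ∷ L)

    joined : ∀ i → ∃ λ p → Chain R (ℓ₁.src i) (ℓ₂.tgt (next i)) p ×
      (∀ {z} → z ∈ₗ p → z ∈ₗ ℓ₁.path i ⊎ z ∈ₗ ℓ₂.path (next i))
    joined i = aux (proj₂ (linked i)) (chain-map there (ℓ₁.chain i)) (chain-map there (ℓ₂.chain (next i)))
      where
      aux : ∀ {a b b′ c p q} → b ≡ b′ ⊎ (b ≡ x × b′ ≡ y) → Chain R a b p → Chain R b′ c q →
        ∃ λ r → Chain R a c r × (∀ {z} → z ∈ₗ r → z ∈ₗ p ⊎ z ∈ₗ q)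
      aux (inj₁ refl) c d = chain-++ c d
      aux (inj₂ (refl , refl)) c d with chain-++ c (here refl ◅ d)
      ... | r , cd , r⊆ = r , cd , λ z∈ → [ inj₁ , (λ { (here refl) → inj₁ (chain-end c) ; (there z∈) → inj₂ z∈ }) ]′ (r⊆ z∈)

    -- Erasing loops yields repetition-free paths without a proof that the two halves meet in the
    -- junction only.
    route : ∀ i → ∃ λ p → Chain R (ℓ₁.src i) (ℓ₂.tgt (next i)) p × Unique p ×
      (∀ {z} → z ∈ₗ p → z ∈ₗ ℓ₁.path i ⊎ z ∈ₗ ℓ₂.path (next i))
    route i with joined i
    ... | p , c , p⊆ with chain-erase c
    ... | q , d , uq , q⊆ = q , d , uq , p⊆ ∘ q⊆

  combined : Linkage (Arc ((x , y) ∷ L)) A B k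
  combined = record
    { src = ℓ₁.src
    ; tgt = ℓ₂.tgt ∘ next
    ; path = proj₁ ∘ route
    ; chain = proj₁ ∘ proj₂ ∘ route
    ; unique = proj₁ ∘ proj₂ ∘ proj₂ ∘ route
    ; src∈ = ℓ₁.src∈
    ; tgt∈ = ℓ₂.tgt∈ ∘ next
    ; disjoint = λ {i} {j} z∈i z∈j →
        disj i j (proj₂ (proj₂ (proj₂ (route i))) z∈i) (proj₂ (proj₂ (proj₂ (route j))) z∈j)
    }
    where
    disj : ∀ i j {z} → z ∈ₗ ℓ₁.path i ⊎ z ∈ₗ ℓ₂.path (next i) →
      z ∈ₗ ℓ₁.path j ⊎ z ∈ₗ ℓ₂.path (next j) → i ≡ j
    disj i j (inj₁ a) (inj₁ b) = ℓ₁.disjoint a b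
    disj i j (inj₁ a) (inj₂ b) = meet a b
    disj i j (inj₂ a) (inj₁ b) = sym (meet b a)
    disj i j (inj₂ a) (inj₂ b) = common-next (proj₂ (linked i))
      (subst (Linked j) (sym (ℓ₂.disjoint a b)) (proj₂ (linked j)))

-- Göring's induction on the arcs: if x → y crosses a small separation (C , D) of the remaining arcs, it is enough to
-- link A to (C ∩ D) ∪ {x} and (C ∩ D) ∪ {y} to B by the remaining arcs.
menger : ∀ {n} (L : List (Fin n × Fin n)) (A B : Subset n) k →
  Linkage (Arc L) A B k ⊎ Σ (Separation (Arc L)) λ s → Separates s A B k
menger [] A B k with k ≤? ∣ A ∩ B ∣
... | yes k≤ = let f , inj , f∈ = k≤∣p∣⇒injection k (A ∩ B) k≤ in inj₁ record
  { src = f ; tgt = f ; path = λ i → f i ∷ [] ; chain = λ _ → stop ; unique = λ _ → [] ∷ []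
  ; src∈ = λ i → proj₁ (x∈p∩q⁻ A B (f∈ i)) ; tgt∈ = λ i → proj₂ (x∈p∩q⁻ A B (f∈ i))
  ; disjoint = λ { (here e) (here e′) → inj (trans (sym e) e′) } }
... | no k≰ = inj₂ (s , id , (λ x∈ → x∈p∪q⁺ (inj₁ x∈)) , ≤-<-trans (p⊆q⇒∣p∣≤∣q∣ S⊆) (≰⇒> k≰))
  where
  s : Separation (Arc [])
  -- `∁ A` makes the two sides cover all vertices, while the separator remains `A ∩ B`.
  s = record { left = A ; right = B ∪ ∁ A ; cover = cov ; no-cross = λ () }
    where
    cov : ∀ v → v ∈ A ⊎ v ∈ B ∪ ∁ A
    cov v with v ∈? A
    ... | yes v∈ = inj₁ v∈
    ... | no v∉ = inj₂ (x∈p∪q⁺ (inj₂ (x∉p⇒x∈∁p v∉)))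
  S⊆ : A ∩ (B ∪ ∁ A) ⊆ A ∩ B
  S⊆ z∈ with x∈p∩q⁻ A _ z∈
  ... | z∈A , z∈r with x∈p∪q⁻ B (∁ A) z∈r
  ... | inj₁ z∈B = x∈p∩q⁺ (z∈A , z∈B)
  ... | inj₂ z∉A = ⊥-elim (x∈∁p⇒x∉p z∉A z∈A)
menger ((x , y) ∷ L) A B k with menger L A B k
... | inj₁ ℓ = inj₁ (linkage-map there ℓ)
... | inj₂ (s , A⊆ , B⊆ , ∣s∣<k) with x ∈? right s | y ∈? left s
-- The separation of the remaining arcs serves for all arcs unless the new arc crosses it from left
-- to right.
... | yes x∈r | _ = inj₂ (record
  { left = left s ; right = right s ; cover = cover s
  ; no-cross = λ { (here refl) → inj₁ x∈r ; (there e) → no-cross s e } } , A⊆ , B⊆ , ∣s∣<k)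
... | no _ | yes y∈l = inj₂ (record
  { left = left s ; right = right s ; cover = cover s
  ; no-cross = λ { (here refl) → inj₂ y∈l ; (there e) → no-cross s e } } , A⊆ , B⊆ , ∣s∣<k)
... | no x∉r | no y∉l with menger L A (separator s ∪ ⁅ x ⁆) k
... | inj₂ (t , A⊆t , S⊆t , ∣t∣<k) =
  inj₂ (t′ , (λ a → x∈p∩q⁺ (A⊆t a , A⊆ a)) , (λ b → x∈p∪q⁺ (inj₂ (B⊆ b))) , ≤-<-trans (p⊆q⇒∣p∣≤∣q∣ sep⊆) ∣t∣<k)
  where
  t′ : Separation (Arc ((x , y) ∷ L))
  -- Since `x` lies in `right t`, the new arc does not cross. Adding `right s` creates no new
  -- separator vertex, because `separator s` already lies in `right t`.
  t′ = record { left = left t ∩ left s ; right = right t ∪ right s ; cover = cov ; no-cross = nc }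
    where
    cov : ∀ v → v ∈ left t ∩ left s ⊎ v ∈ right t ∪ right s
    cov v with cover t v | cover s v
    ... | inj₂ r | _ = inj₂ (x∈p∪q⁺ (inj₁ r))
    ... | inj₁ _ | inj₂ r = inj₂ (x∈p∪q⁺ (inj₂ r))
    ... | inj₁ l | inj₁ l′ = inj₁ (x∈p∩q⁺ (l , l′))
    nc : ∀ {a b} → Arc ((x , y) ∷ L) a b → a ∈ right t ∪ right s ⊎ b ∈ left t ∩ left s
    nc (here refl) = inj₁ (x∈p∪q⁺ (inj₁ (S⊆t (x∈p∪q⁺ (inj₂ (x∈⁅x⁆ x))))))
    nc (there e) with no-cross t e | no-cross s e
    ... | inj₁ r | _ = inj₁ (x∈p∪q⁺ (inj₁ r))
    ... | inj₂ _ | inj₁ r = inj₁ (x∈p∪q⁺ (inj₂ r))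
    ... | inj₂ l | inj₂ l′ = inj₂ (x∈p∩q⁺ (l , l′))
  sep⊆ : separator t′ ⊆ separator t
  sep⊆ z∈ with x∈p∩q⁻ (left t ∩ left s) _ z∈
  ... | z∈l , z∈r with x∈p∩q⁻ (left t) _ z∈l | x∈p∪q⁻ (right t) _ z∈r
  ... | z∈lt , _ | inj₁ z∈rt = x∈p∩q⁺ (z∈lt , z∈rt)
  ... | z∈lt , z∈ls | inj₂ z∈rs = x∈p∩q⁺ (z∈lt , S⊆t (x∈p∪q⁺ (inj₁ (x∈p∩q⁺ (z∈ls , z∈rs)))))
... | inj₁ ℓ₁ with menger L (separator s ∪ ⁅ y ⁆) B k
... | inj₂ (t , S⊆t , B⊆t , ∣t∣<k) =
  inj₂ (t′ , (λ a → x∈p∪q⁺ (inj₂ (A⊆ a))) , (λ b → x∈p∩q⁺ (B⊆t b , B⊆ b)) , ≤-<-trans (p⊆q⇒∣p∣≤∣q∣ sep⊆) ∣t∣<k)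
  where
  t′ : Separation (Arc ((x , y) ∷ L))
  -- The mirror image: `y` and `separator s` lie in `left t`.
  t′ = record { left = left t ∪ left s ; right = right t ∩ right s ; cover = cov ; no-cross = nc }
    where
    cov : ∀ v → v ∈ left t ∪ left s ⊎ v ∈ right t ∩ right s
    cov v with cover t v | cover s v
    ... | inj₁ l | _ = inj₁ (x∈p∪q⁺ (inj₁ l))
    ... | inj₂ _ | inj₁ l = inj₁ (x∈p∪q⁺ (inj₂ l))
    ... | inj₂ r | inj₂ r′ = inj₂ (x∈p∩q⁺ (r , r′))
    nc : ∀ {a b} → Arc ((x , y) ∷ L) a b → a ∈ right t ∩ right s ⊎ b ∈ left t ∪ left s
    nc (here refl) = inj₂ (x∈p∪q⁺ (inj₁ (S⊆t (x∈p∪q⁺ (inj₂ (x∈⁅x⁆ y))))))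
    nc (there e) with no-cross t e | no-cross s e
    ... | inj₂ l | _ = inj₂ (x∈p∪q⁺ (inj₁ l))
    ... | inj₁ _ | inj₂ l = inj₂ (x∈p∪q⁺ (inj₂ l))
    ... | inj₁ r | inj₁ r′ = inj₁ (x∈p∩q⁺ (r , r′))
  sep⊆ : separator t′ ⊆ separator t
  sep⊆ z∈ with x∈p∩q⁻ (left t ∪ left s) _ z∈
  ... | z∈l , z∈r with x∈p∪q⁻ (left t) _ z∈l | x∈p∩q⁻ (right t) _ z∈r
  ... | inj₁ z∈lt | z∈rt , _ = x∈p∩q⁺ (z∈lt , z∈rt)
  ... | inj₂ z∈ls | z∈rt , z∈rs = x∈p∩q⁺ (S⊆t (x∈p∪q⁺ (inj₁ (x∈p∩q⁺ (z∈ls , z∈rs)))) , z∈rt)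
... | inj₁ ℓ₂ = inj₁ (Combine.combined s A⊆ B⊆ ∣s∣<k
  ([ id , ⊥-elim ∘ x∉r ]′ (cover s x)) ([ ⊥-elim ∘ y∉l , id ]′ (cover s y)) y∉l ℓ₁ ℓ₂)

-- Menger's theorem for two vertices of a graph

Adj : ∀ {n} → Graph n → Fin n → Fin n → Set
Adj G x y = adj G x y ≡ true

Adj-sym : ∀ {n} (G : Graph n) {x y} → Adj G x y → Adj G y x
Adj-sym G {x} {y} e = trans (adj-sym G y x) e

Adj⇒≢ : ∀ {n} (G : Graph n) {x y} → Adj G x y → x ≢ y
Adj⇒≢ G {x} e refl with trans (sym e) (irrefl G x)
... | ()

walk⇒chain : ∀ {n} {G : Graph n} {u v p} → Walk G u v p → Chain (Adj G) u v p
walk⇒chain here = stop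
walk⇒chain (step e w) = e ◅ walk⇒chain w

chain⇒walk : ∀ {n} {G : Graph n} {u v p} → Chain (Adj G) u v p → Walk G u v p
chain⇒walk stop = here
chain⇒walk (e ◅ c) = step e (chain⇒walk c)

∈-pairs : ∀ {m} (x y : Fin m) → (x , y) ∈ₗ pairs m
∈-pairs {m} x y = ∈-concatMap⁺ (λ x → map (λ y → (x , y)) (allFin m)) (lose (∈-allFin x) (∈-map⁺ (x ,_) (∈-allFin y)))

module _ {n : ℕ} (G : Graph n) where

  neighbours : Fin n → Subset n
  neighbours u = compr (λ w → adj G u w Boolₚ.≟ true)

  private
    adj? : (e : Fin n × Fin n) → Dec (Adj G (proj₁ e) (proj₂ e))
    adj? e = adj G (proj₁ e) (proj₂ e) Boolₚ.≟ true

  -- Each path is extended by `u` and `v`. It may already pass through one of them, so loops are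
  -- erased; this keeps it within its own linkage path and the two ends.
  linkage⇒disjointPaths : ∀ {k u v} → Linkage (Adj G) (neighbours u) (neighbours v) k → DisjointPaths G k u v
  linkage⇒disjointPaths {k} {u} {v} ℓ = proj₁ ∘ route , (λ i → let _ , c , uq , _ = route i in chain⇒walk c , uq) ,
    λ i j i≢j w w∈i w∈j → shared i≢j (proj₂ (proj₂ (proj₂ (route i))) w∈i) (proj₂ (proj₂ (proj₂ (route j))) w∈j)
    where
    open Linkage ℓ
    Within : Fin k → Fin n → Set
    Within i z = (z ≡ u ⊎ z ≡ v) ⊎ z ∈ₗ path i
    route : ∀ i → ∃ λ p → Chain (Adj G) u v p × Unique p × (∀ {z} → z ∈ₗ p → Within i z)
    route i with chain-++ (chain i) (Adj-sym G (∈-compr⁻ (λ w → adj G v w Boolₚ.≟ true) (tgt∈ i)) ◅ stop)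
    ... | p , c , p⊆ with chain-erase (∈-compr⁻ (λ w → adj G u w Boolₚ.≟ true) (src∈ i) ◅ c)
    ... | q , d , uq , q⊆ = q , d , uq , within ∘ q⊆
      where
      within : ∀ {z} → z ∈ₗ u ∷ p → Within i z
      within (here z≡u) = inj₁ (inj₁ z≡u)
      within (there z∈) with p⊆ z∈
      ... | inj₁ z∈path = inj₂ z∈path
      ... | inj₂ (here refl) = inj₂ (chain-end (chain i))
      ... | inj₂ (there (here z≡v)) = inj₁ (inj₂ z≡v)
    shared : ∀ {i j w} → i ≢ j → Within i w → Within j w → w ≡ u ⊎ w ≡ v
    shared i≢j (inj₁ e) _ = e
    shared i≢j (inj₂ _) (inj₁ e) = e
    shared i≢j (inj₂ a) (inj₂ b) = ⊥-elim (i≢j (disjoint a b))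

  -- Menger's theorem between the two neighbourhoods. The resulting separation need not place `u`
  -- and `v` correctly, so each is put on its own side and removed from the other, which does not
  -- enlarge the separator.
  menger-vertices : ∀ k u v → u ≢ v → adj G u v ≡ false →
    DisjointPaths G k u v ⊎
    Σ (Separation (Adj G)) λ s → u ∉ right s × v ∉ left s × ∣ separator s ∣ < k
  menger-vertices k u v u≢v u≁v with menger (filter adj? (pairs n)) (neighbours u) (neighbours v) k
  ... | inj₁ ℓ = inj₁ (linkage⇒disjointPaths (linkage-map (λ e → proj₂ (∈-filter⁻ adj? {xs = pairs n} e)) ℓ))
  ... | inj₂ (s , Nu⊆ , Nv⊆ , ∣s∣<k) = inj₂ (s′ , u∉ , v∉ , ≤-<-trans (p⊆q⇒∣p∣≤∣q∣ sep⊆) ∣s∣<k)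
    where
    L′ R′ : Subset n
    L′ = (left s - v) ∪ ⁅ u ⁆
    R′ = (right s - u) ∪ ⁅ v ⁆
    ∈L′ : ∀ {z} → z ∈ left s → z ≢ v → z ∈ L′
    ∈L′ z∈ z≢ = x∈p∪q⁺ (inj₁ (x∈p∧x≢y⇒x∈p-y z∈ z≢))
    ∈R′ : ∀ {z} → z ∈ right s → z ≢ u → z ∈ R′
    ∈R′ z∈ z≢ = x∈p∪q⁺ (inj₁ (x∈p∧x≢y⇒x∈p-y z∈ z≢))
    u∈L′ : u ∈ L′
    u∈L′ = x∈p∪q⁺ (inj₂ (x∈⁅x⁆ u))
    v∈R′ : v ∈ R′
    v∈R′ = x∈p∪q⁺ (inj₂ (x∈⁅x⁆ v))
    u∉ : u ∉ R′
    u∉ u∈ with x∈p∪q⁻ (right s - u) ⁅ v ⁆ u∈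
    ... | inj₁ h = proj₂ (x∈p-y⁻ (right s) h) refl
    ... | inj₂ h = u≢v (x∈⁅y⁆⇒x≡y v h)
    v∉ : v ∉ L′
    v∉ v∈ with x∈p∪q⁻ (left s - v) ⁅ u ⁆ v∈
    ... | inj₁ h = proj₂ (x∈p-y⁻ (left s) h) refl
    ... | inj₂ h = u≢v (sym (x∈⁅y⁆⇒x≡y u h))
    cov : ∀ z → z ∈ L′ ⊎ z ∈ R′
    cov z with z ≟ u | z ≟ v
    ... | yes refl | _ = inj₁ u∈L′
    ... | no _ | yes refl = inj₂ v∈R′
    ... | no z≢u | no z≢v = [ (λ z∈ → inj₁ (∈L′ z∈ z≢v)) , (λ z∈ → inj₂ (∈R′ z∈ z≢u)) ]′ (cover s z)
    nonadjacent : ¬ Adj G u v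
    nonadjacent e with trans (sym e) u≁v
    ... | ()
    nc : ∀ {x y} → Adj G x y → x ∈ R′ ⊎ y ∈ L′
    nc {x} {y} e with x ≟ u | x ≟ v | y ≟ u | y ≟ v
    ... | _ | yes refl | _ | _ = inj₁ v∈R′
    ... | _ | _ | yes refl | _ = inj₂ u∈L′
    -- An edge `uv` would cross the modified separation, which non-adjacency excludes. Other edges
    -- at `u` or `v` lead into the neighbourhoods, which already lie on the proper sides.
    ... | yes refl | no _ | no _ | yes refl = ⊥-elim (nonadjacent e)
    ... | yes refl | no _ | no _ | no y≢v = inj₂ (∈L′ (Nu⊆ (∈-compr⁺ (λ w → adj G u w Boolₚ.≟ true) e)) y≢v)
    ... | no x≢u | no _ | no _ | yes refl = inj₁ (∈R′ (Nv⊆ (∈-compr⁺ (λ w → adj G v w Boolₚ.≟ true) (Adj-sym G e))) x≢u)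
    ... | no x≢u | no _ | no _ | no y≢v =
      [ (λ x∈ → inj₁ (∈R′ x∈ x≢u)) , (λ y∈ → inj₂ (∈L′ y∈ y≢v)) ]′ (no-cross s (∈-filter⁺ adj? (∈-pairs x y) e))
    s′ : Separation (Adj G)
    s′ = record { left = L′ ; right = R′ ; cover = cov ; no-cross = nc }
    sep⊆ : separator s′ ⊆ separator s
    sep⊆ {z} z∈ with x∈p∩q⁻ L′ R′ z∈
    ... | z∈L , z∈R with x∈p∪q⁻ (left s - v) ⁅ u ⁆ z∈L | x∈p∪q⁻ (right s - u) ⁅ v ⁆ z∈R
    ... | inj₁ a | inj₁ b = x∈p∩q⁺ (proj₁ (x∈p-y⁻ (left s) a) , proj₁ (x∈p-y⁻ (right s) b))
    ... | inj₂ a | _ = ⊥-elim (u∉ (subst (_∈ R′) (x∈⁅y⁆⇒x≡y u a) z∈R))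
    ... | inj₁ _ | inj₂ b = ⊥-elim (v∉ (subst (_∈ L′) (x∈⁅y⁆⇒x≡y v b) z∈L))

-- Rooted trees

least : ∀ {P : ℕ → Set} → Decidable P → ∀ {k} → P k → ∃ λ ℓ → P ℓ × (∀ {j} → P j → ℓ ≤ j)
least P? {zero} pk = 0 , pk , λ _ → z≤n
least {P} P? {suc k} pk with P? 0
... | yes p0 = 0 , p0 , λ _ → z≤n
... | no ¬p0 with least {P ∘ suc} (P? ∘ suc) pk
... | ℓ , pℓ , min = suc ℓ , pℓ , λ { {zero} p0 → ⊥-elim (¬p0 p0) ; {suc j} pj → s≤s (min pj) }

-- The value `parent root` is left open, and `depth` need not be the distance to the root: it only
-- has to decrease along `parent`, which drives the recursion towards the root.
record Rooting {m : ℕ} (T : Graph m) (root : Fin m) : Set where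
  field
    parent       : Fin m → Fin m
    depth        : Fin m → ℕ
    parent-adj   : ∀ {x} → x ≢ root → Adj T x (parent x)
    depth-parent : ∀ {x} → x ≢ root → depth (parent x) < depth x
    adj-parent   : ∀ {x y} → Adj T x y → (x ≢ root × parent x ≡ y) ⊎ (y ≢ root × parent y ≡ x)

  infix 4 _⊑_ _⊑?_

  -- The ancestor order: `x` lies on the way from `y` to the root.
  data _⊑_ (x : Fin m) : Fin m → Set where
    ⊑-refl : x ⊑ x
    ⊑-step : ∀ {y} → y ≢ root → x ⊑ parent y → x ⊑ y

  ⊑-trans : ∀ {x y z} → x ⊑ y → y ⊑ z → x ⊑ z
  ⊑-trans p ⊑-refl = p
  ⊑-trans p (⊑-step z≢ q) = ⊑-step z≢ (⊑-trans p q)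

  parent-⊑ : ∀ {x} → x ≢ root → parent x ⊑ x
  parent-⊑ x≢ = ⊑-step x≢ ⊑-refl

  ⊑⇒depth≤ : ∀ {x y} → x ⊑ y → depth x ≤ depth y
  ⊑⇒depth≤ ⊑-refl = ≤-refl
  ⊑⇒depth≤ (⊑-step y≢ p) = ≤-trans (⊑⇒depth≤ p) (<⇒≤ (depth-parent y≢))

  ⊑∧≢⇒depth< : ∀ {x y} → x ⊑ y → x ≢ y → depth x < depth y
  ⊑∧≢⇒depth< ⊑-refl x≢y = ⊥-elim (x≢y refl)
  ⊑∧≢⇒depth< (⊑-step y≢ p) _ = ≤-<-trans (⊑⇒depth≤ p) (depth-parent y≢)

  upward-rec : (P : Fin m → Set) → P root → (∀ {x} → x ≢ root → P (parent x) → P x) → ∀ x → P x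
  upward-rec P base up x = aux x (<-wellFounded (depth x))
    where
    aux : ∀ x → Acc _<_ (depth x) → P x
    aux x (acc rec) with x ≟ root
    ... | yes refl = base
    ... | no x≢ = up x≢ (aux (parent x) (rec (depth-parent x≢)))

  root-⊑ : ∀ x → root ⊑ x
  root-⊑ = upward-rec (root ⊑_) ⊑-refl ⊑-step

  _⊑?_ : ∀ x y → Dec (x ⊑ y)
  x ⊑? y = upward-rec (λ y → Dec (x ⊑ y)) at-root up y
    where
    at-root : Dec (x ⊑ root)
    at-root with x ≟ root
    ... | yes refl = yes ⊑-refl
    ... | no x≢ = no λ { ⊑-refl → x≢ refl ; (⊑-step r≢ _) → r≢ refl }
    up : ∀ {y} → y ≢ root → Dec (x ⊑ parent y) → Dec (x ⊑ y)
    up {y} y≢ (yes p) = yes (⊑-step y≢ p)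
    up {y} y≢ (no ¬p) with x ≟ y
    ... | yes refl = yes ⊑-refl
    ... | no x≢y = no λ { ⊑-refl → x≢y refl ; (⊑-step _ p) → ¬p p }

  ⊑-parent : ∀ {x y} → x ≢ y → x ⊑ y → y ≢ root × x ⊑ parent y
  ⊑-parent x≢y ⊑-refl = ⊥-elim (x≢y refl)
  ⊑-parent _ (⊑-step y≢ p) = y≢ , p

  -- An edge enters the branch at `x` only at `x` itself.
  chain-outside : ∀ {x w y p} → Chain (Adj T) w y p → x ∉ₗ p → ¬ x ⊑ w → ¬ x ⊑ y
  chain-outside stop x∉ ¬x⊑w = ¬x⊑w
  chain-outside (e ◅ c) x∉ ¬x⊑w = chain-outside c (x∉ ∘ there) ¬x⊑z
    where
    ¬x⊑z : ¬ _ ⊑ _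
    ¬x⊑z x⊑z with adj-parent e
    ... | inj₁ (w≢ , refl) = ¬x⊑w (⊑-step w≢ x⊑z)
    ... | inj₂ (z≢ , refl) = ¬x⊑w (proj₂ (⊑-parent (λ { refl → x∉ (there (chain-start c)) }) x⊑z))

  -- An edge leaves the branch at `x` only towards `parent x`.
  chain-inside : ∀ {x w y p} → Chain (Adj T) w y p → parent x ∉ₗ p → x ⊑ w → x ⊑ y
  chain-inside stop x∉ x⊑w = x⊑w
  chain-inside (e ◅ c) x∉ x⊑w with adj-parent e
  ... | inj₂ (z≢ , refl) = chain-inside c (x∉ ∘ there) (⊑-step z≢ x⊑w)
  ... | inj₁ (w≢ , refl) = chain-inside c (x∉ ∘ there)
    (proj₂ (⊑-parent (λ { refl → x∉ (there (chain-start c)) }) x⊑w))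

  -- The chain must pass through `parent x`. This turns connectedness of the bags of a vertex into
  -- closure under `parent`.
  chain-exit : ∀ {x z y p} {Q : Fin m → Set} → Chain (Adj T) z y p → (∀ {w} → w ∈ₗ p → Q w) →
    x ⊑ z → ¬ x ⊑ y → x ≢ root × Q (parent x)
  chain-exit stop q x⊑z ¬x⊑y = ⊥-elim (¬x⊑y x⊑z)
  chain-exit {x} (_◅_ {w = z′} e c) q x⊑z ¬x⊑y with x ⊑? z′ | adj-parent e | x⊑z
  ... | yes x⊑z′ | _ | _ = chain-exit c (q ∘ there) x⊑z′ ¬x⊑y
  ... | no ¬x⊑z′ | inj₂ (z′≢ , refl) | _ = ⊥-elim (¬x⊑z′ (⊑-step z′≢ x⊑z))
  ... | no ¬x⊑z′ | inj₁ (z≢ , refl) | ⊑-refl = z≢ , q (there (chain-start c))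
  ... | no ¬x⊑z′ | inj₁ (z≢ , refl) | ⊑-step _ p = ⊥-elim (¬x⊑z′ p)

  chain-to-root : ∀ x → ∃ λ p → Chain (Adj T) x root p
  chain-to-root = upward-rec _ (_ , stop) (λ x≢ c → _ , parent-adj x≢ ◅ proj₂ c)

  connected : Connected T
  connected x y with chain-reverse (Adj-sym T) (proj₂ (chain-to-root y))
  ... | _ , c , _ with chain-++ (proj₂ (chain-to-root x)) c
  ... | _ , d , _ = _ , chain⇒walk d

  -- The rest of a cycle through `x` is a chain avoiding `x`. Starting at the parent of `x`, it
  -- cannot reach a child of `x`, and it would have to be trivial to end at the parent. Starting at
  -- a child `w`, it stays in the branch at `w`, so it ends neither at the parent of `x` nor at
  -- another child.
  no-cycle : ¬ HasCycle T
  no-cycle (x , y , p , (walk , uq) , 3≤ , yx) = aux (walk⇒chain walk) uq 3≤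
    where
    not-closed : ∀ {w p} → Chain (Adj T) w w p → Unique p → ¬ 2 ≤ length p
    not-closed stop _ (s≤s ())
    not-closed (e ◅ c) (w≢ ∷ _) _ = All.lookup w≢ (chain-end c) refl
    aux : ∀ {p} → Chain (Adj T) x y p → Unique p → ¬ 3 ≤ length p
    aux stop _ (s≤s ())
    aux (e ◅ c) (x≢ ∷ uq) (s≤s 2≤) with adj-parent e | adj-parent yx
    ... | inj₁ (x≢r , refl) | inj₁ (y≢r , refl) = chain-outside c (λ x∈ → All.lookup x≢ x∈ refl)
      (λ h → <⇒≱ (depth-parent x≢r) (⊑⇒depth≤ h)) (parent-⊑ y≢r)
    ... | inj₁ (x≢r , refl) | inj₂ (_ , refl) = not-closed c uq 2≤
    ... | inj₂ (w≢r , refl) | inj₂ (x≢r , refl) =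
      <⇒≱ (depth-parent w≢r) (≤-trans (⊑⇒depth≤ (chain-inside c (λ x∈ → All.lookup x≢ x∈ refl) ⊑-refl)) (<⇒≤ (depth-parent x≢r)))
    ... | inj₂ (w≢r , pw≡x) | inj₁ (y≢r , py≡x)
      with chain-inside c (λ x∈ → All.lookup x≢ x∈ (sym pw≡x)) ⊑-refl
    ... | ⊑-refl = not-closed c uq 2≤
    ... | ⊑-step _ p = <⇒≱ (depth-parent w≢r) (≤-trans (⊑⇒depth≤ p) (≤-reflexive (cong depth (trans py≡x (sym pw≡x)))))

  rooting⇒isTree : IsTree T
  rooting⇒isTree = 1≤m root , connected , no-cycle
    where
    1≤m : ∀ {m} → Fin m → 1 ≤ m
    1≤m zero = s≤s z≤n
    1≤m (suc _) = s≤s z≤n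

-- Rooting a tree by distances

module _ {m : ℕ} (T : Graph m) (isTree : IsTree T) (root : Fin m) where

  private
    data Reach : ℕ → Fin m → Set where
      at-root : Reach 0 root
      via     : ∀ {x y ℓ} → Adj T x y → Reach ℓ y → Reach (suc ℓ) x

    reach? : ∀ ℓ x → Dec (Reach ℓ x)
    reach? zero x with x ≟ root
    ... | yes refl = yes at-root
    ... | no x≢ = no λ { at-root → x≢ refl }
    reach? (suc ℓ) x = map′ (λ { (y , e , r) → via e r }) (λ { (via e r) → _ , e , r })
      (any? (λ y → (adj T x y Boolₚ.≟ true) ×-dec reach? ℓ y))

    reach : ∀ x → ∃ λ ℓ → Reach ℓ x
    reach x = aux (walk⇒chain (proj₂ (proj₁ (proj₂ isTree) x root)))
      where
      aux : ∀ {x p} → Chain (Adj T) x root p → ∃ λ ℓ → Reach ℓ x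
      aux stop = 0 , at-root
      aux (e ◅ c) = _ , via e (proj₂ (aux c))

    shortest : ∀ x → ∃ λ ℓ → Reach ℓ x × (∀ {j} → Reach j x → ℓ ≤ j)
    shortest x = least (λ ℓ → reach? ℓ x) (proj₂ (reach x))

    dist : Fin m → ℕ
    dist x = proj₁ (shortest x)

    dist≤ : ∀ {x ℓ} → Reach ℓ x → dist x ≤ ℓ
    dist≤ {x} = proj₂ (proj₂ (shortest x))

    closer : ∀ x → x ≢ root → ∃ λ y → Adj T x y × dist y < dist x
    closer x x≢ with shortest x
    ... | _ , at-root , _ = ⊥-elim (x≢ refl)
    ... | _ , via e r , _ = _ , e , s≤s (dist≤ r)

    par : Fin m → Fin m
    par x with x ≟ root
    ... | yes _ = root
    ... | no x≢ = proj₁ (closer x x≢)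

    par-adj : ∀ {x} → x ≢ root → Adj T x (par x)
    par-adj {x} x≢ with x ≟ root
    ... | yes refl = ⊥-elim (x≢ refl)
    ... | no x≢ = proj₁ (proj₂ (closer x x≢))

    dist-par : ∀ {x} → x ≢ root → dist (par x) < dist x
    dist-par {x} x≢ with x ≟ root
    ... | yes refl = ⊥-elim (x≢ refl)
    ... | no x≢ = proj₂ (proj₂ (closer x x≢))

    -- After the first step towards the root the distance is below `dist x`, so `x` is never met.
    avoiding : ∀ x y → Acc _<_ (dist y) → dist y ≤ dist x → x ≢ y → ∃ λ p → Chain (Adj T) y root p × x ∉ₗ p
    avoiding x y (acc rec) dy≤dx x≢y with y ≟ root
    ... | yes refl = _ , stop , λ { (here refl) → x≢y refl }
    ... | no y≢ with avoiding x (par y) (rec (dist-par y≢)) (≤-trans (<⇒≤ (dist-par y≢)) dy≤dx)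
                       (λ { refl → <⇒≱ (dist-par y≢) dy≤dx })
    ... | p , c , x∉p = _ , par-adj y≢ ◅ c , λ { (here refl) → x≢y refl ; (there x∈) → x∉p x∈ }

    -- Two neighbours of x that are not farther from the root than x close a cycle through x.
    unique-closer : ∀ {x y z} → Adj T x y → Adj T x z → dist y ≤ dist x → dist z ≤ dist x → y ≡ z
    unique-closer {x} {y} {z} xy xz dy≤ dz≤ with y ≟ z
    ... | yes y≡z = y≡z
    ... | no y≢z
      with avoiding x y (<-wellFounded _) dy≤ (Adj⇒≢ T xy) | avoiding x z (<-wellFounded _) dz≤ (Adj⇒≢ T xz)
    ... | p , c , x∉p | q , d , x∉q with chain-reverse (Adj-sym T) d
    ... | q′ , d′ , q′⊆ with chain-++ c d′
    ... | r , cd , r⊆ with chain-erase cd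
    ... | s , e , uq , s⊆ = ⊥-elim (proj₂ (proj₂ isTree)
      (x , z , x ∷ s , (step xy (chain⇒walk e) , All.tabulate (λ {w} w∈ x≡w → x∉s (subst (_∈ₗ s) (sym x≡w) w∈)) ∷ uq) , s≤s (two e) , Adj-sym T xz))
      where
      x∉s : x ∉ₗ s
      x∉s x∈ = [ x∉p , x∉q ∘ q′⊆ ]′ (r⊆ (s⊆ x∈))
      two : ∀ {s} → Chain (Adj T) y z s → 2 ≤ length s
      two stop = ⊥-elim (y≢z refl)
      two (_ ◅ stop) = s≤s (s≤s z≤n)
      two (_ ◅ (_ ◅ _)) = s≤s (s≤s z≤n)

    -- This covers a potential edge between equally distant nodes too: `y` and `par x` are both
    -- neighbours of `x` that are not farther from the root, so they coincide.
    toward-root : ∀ {x y} → Adj T x y → dist y ≤ dist x → x ≢ root × par x ≡ y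
    toward-root {x} {y} xy dy≤ = x≢ , unique-closer (par-adj x≢) xy (<⇒≤ (dist-par x≢)) dy≤
      where
      x≢ : x ≢ root
      x≢ refl with shortest y | ≤-trans dy≤ (dist≤ at-root)
      ... | _ , at-root , _ | _ = Adj⇒≢ T xy refl
      ... | _ , via _ _ , _ | ()

  isTree⇒rooting : Rooting T root
  isTree⇒rooting = record
    { parent = par ; depth = dist ; parent-adj = par-adj ; depth-parent = dist-par
    ; adj-parent = λ {x} {y} xy → [ (λ dx≤dy → inj₂ (toward-root (Adj-sym T xy) dx≤dy)) , (λ dy≤dx → inj₁ (toward-root xy dy≤dx)) ]′
        (≤-total (dist x) (dist y)) }

-- Tree decompositions of rooted trees

foldr-⊔-attained : ∀ {A : Set} {k} (f : A → ℕ) (xs : List A) → 0 < k → k ≤ foldr _⊔_ 0 (map f xs) → ∃ λ x → k ≤ f x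
foldr-⊔-attained f [] (s≤s _) ()
foldr-⊔-attained f (x ∷ xs) 0<k k≤ with ⊔-sel (f x) (foldr _⊔_ 0 (map f xs))
... | inj₁ e = x , ≤-trans k≤ (≤-reflexive e)
... | inj₂ e = foldr-⊔-attained f xs 0<k (≤-trans k≤ (≤-reflexive e))

foldr-⊔-bound : ∀ {A : Set} {k} (f : A → ℕ) (xs : List A) → foldr _⊔_ 0 (map f xs) ≤ k → ∀ {x} → x ∈ₗ xs → f x ≤ k
foldr-⊔-bound f (y ∷ xs) ≤k (here refl) = ≤-trans (m≤m⊔n (f y) _) ≤k
foldr-⊔-bound f (y ∷ xs) ≤k (there x∈) = foldr-⊔-bound f xs (≤-trans (m≤n⊔m (f y) _) ≤k) x∈

module _ {n : ℕ} {G : Graph n} (D : TreeDecomp G) where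

  adhesion≤adh : ∀ {k x y} → adh D ≤ k → Adj (T D) x y → ∣ χ D x ∩ χ D y ∣ ≤ k
  adhesion≤adh {x = x} {y} ≤k e with foldr-⊔-bound _ (pairs (m D)) ≤k (∈-pairs x y)
  ... | h with adj (T D) x y | h | e
  ... | true | h′ | _ = h′

  -- `0 < k` excludes the value 0 that stands for non-adjacent pairs and for the empty maximum, so
  -- an actual edge is found.
  adh-attained : ∀ {k} → 0 < k → k ≤ adh D → ∃₂ λ x y → Adj (T D) x y × k ≤ ∣ χ D x ∩ χ D y ∣
  adh-attained 0<k k≤ with foldr-⊔-attained _ (pairs (m D)) 0<k k≤
  ... | (x , y) , h with adj (T D) x y in e | h
  ... | true | h′ = x , y , e , h′
  ... | false | h′ = ⊥-elim (<⇒≱ 0<k h′)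

module _ {m : ℕ} {T : Graph m} {root : Fin m} (R : Rooting T root) where
  open Rooting R

  -- Connected sets of nodes are encoded by a highest node and closure under `parent` up to it,
  -- which can be checked one step at a time.
  UpClosedTo : Fin m → (Fin m → Set) → Set
  UpClosedTo top P = ∀ {x} → P x → x ≡ top ⊎ (x ≢ root × P (parent x))

  HasTop : (Fin m → Set) → Set
  HasTop P = ∃ λ top → P top × UpClosedTo top P

  chain-to-top : ∀ {P top} → UpClosedTo top P → ∀ x → P x →
    ∃ λ p → Chain (Adj T) x top p × (∀ {z} → z ∈ₗ p → P z)
  chain-to-top {P} {top} up = upward-rec (λ x → P x → _) at-root step′
    where
    Goal : Fin m → Set
    Goal x = P x → ∃ λ p → Chain (Adj T) x top p × (∀ {z} → z ∈ₗ p → P z)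
    at-root : Goal root
    at-root px with up px
    ... | inj₁ refl = _ , stop , λ { (here refl) → px }
    ... | inj₂ (r≢ , _) = ⊥-elim (r≢ refl)
    step′ : ∀ {x} → x ≢ root → Goal (parent x) → Goal x
    step′ x≢ ih px with up px
    ... | inj₁ refl = _ , stop , λ { (here refl) → px }
    ... | inj₂ (_ , pp) with ih pp
    ... | p , c , p⊆ = _ , parent-adj x≢ ◅ c , λ { (here refl) → px ; (there z∈) → p⊆ z∈ }

  hasTop⇒connected : ∀ {P} → HasTop P → ∀ {x y} → P x → P y →
    ∃ λ p → Chain (Adj T) x y p × (∀ {z} → z ∈ₗ p → P z)
  hasTop⇒connected (top , _ , up) {x} {y} px py with chain-to-top up x px | chain-to-top up y py
  ... | p , c , p⊆ | q , d , q⊆ with chain-reverse (Adj-sym T) d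
  ... | q′ , d′ , q′⊆ with chain-++ c d′
  ... | r , e , r⊆ = r , e , λ z∈ → [ p⊆ , q⊆ ∘ q′⊆ ]′ (r⊆ z∈)

  -- A node of least depth serves as top: any other `x` in the set is not above it, so a chain from
  -- `x` to it leaves the branch at `x` through `parent x`.
  connected⇒hasTop : ∀ {P : Fin m → Set} → Decidable P → ∃ P →
    (∀ {x y} → P x → P y → ∃ λ p → Chain (Adj T) x y p × (∀ {z} → z ∈ₗ p → P z)) → HasTop P
  connected⇒hasTop {P} P? (x₀ , px₀) conn
    with least {λ ℓ → ∃ λ x → P x × depth x ≡ ℓ} (λ ℓ → any? (λ x → P? x ×-dec (depth x ℕₚ.≟ ℓ))) (x₀ , px₀ , refl)
  ... | _ , (top , ptop , refl) , min = top , ptop , up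
    where
    up : UpClosedTo top P
    up {x} px with x ≟ top
    ... | yes x≡top = inj₁ x≡top
    ... | no x≢top with conn px ptop
    ... | p , c , p⊆ = inj₂ (chain-exit c p⊆ ⊑-refl
      (λ x⊑top → <⇒≱ (⊑∧≢⇒depth< x⊑top x≢top) (min (x , px , refl))))

  rootedDecomp : ∀ {n} {G : Graph n} (χ : Fin m → Subset n) →
    (∀ v → HasTop (λ x → v ∈ χ x)) →
    (∀ {u v} → Adj G u v → ∃ λ x → u ∈ χ x × v ∈ χ x) → TreeDecomp G
  rootedDecomp χ tops edges = record
    { m = m ; T = T ; isTree = rooting⇒isTree ; χ = χ
    ; coverV = λ v → let x , v∈ , _ = tops v in x , v∈
    ; coverE = λ u v → edges
    ; connV = λ v x y v∈x v∈y → let p , c , p⊆ = hasTop⇒connected (tops v) v∈x v∈y in p , chain⇒walk c , All.tabulate p⊆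
    }

rooted-adh< : ∀ {n k} {G : Graph n} (D : TreeDecomp G) {root} (R : Rooting (T D) root) → 0 < k →
  (∀ {x} → x ≢ root → ∣ χ D x ∩ χ D (Rooting.parent R x) ∣ < k) → adh D < k
rooted-adh< D {root} R 0<k edge< = ≰⇒> λ k≤ → let x , y , e , k≤xy = adh-attained D 0<k k≤ in <⇒≱ (bound x y (adj-parent e)) k≤xy
  where
  open Rooting R
  bound : ∀ x y → (x ≢ root × parent x ≡ y) ⊎ (y ≢ root × parent y ≡ x) → ∣ χ D x ∩ χ D y ∣ < _
  bound x _ (inj₁ (x≢ , refl)) = edge< x≢
  bound _ y (inj₂ (y≢ , refl)) = ≤-<-trans (≤-reflexive (cong ∣_∣ (∩-comm (χ D (parent y)) (χ D y)))) (edge< y≢)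

-- Two copies of a rooted tree joined at their roots

module _ {m : ℕ} (T : Graph m) (root : Fin m) where

  private
    jadj : Fin m ⊎ Fin m → Fin m ⊎ Fin m → Bool
    jadj (inj₁ a) (inj₁ b) = adj T a b
    jadj (inj₂ a) (inj₂ b) = adj T a b
    jadj (inj₁ a) (inj₂ b) = ⌊ (a ≟ root) ×-dec (b ≟ root) ⌋
    jadj (inj₂ a) (inj₁ b) = ⌊ (b ≟ root) ×-dec (a ≟ root) ⌋

    jadj-sym : ∀ p q → jadj p q ≡ jadj q p
    jadj-sym (inj₁ a) (inj₁ b) = adj-sym T a b
    jadj-sym (inj₂ a) (inj₂ b) = adj-sym T a b
    jadj-sym (inj₁ a) (inj₂ b) = refl
    jadj-sym (inj₂ a) (inj₁ b) = refl

    jadj-irrefl : ∀ p → jadj p p ≡ false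
    jadj-irrefl (inj₁ a) = irrefl T a
    jadj-irrefl (inj₂ a) = irrefl T a

  double : Graph (m + m)
  double = record
    { adj = λ p q → jadj (splitAt m p) (splitAt m q)
    ; sym = λ p q → jadj-sym (splitAt m p) (splitAt m q)
    ; irrefl = λ p → jadj-irrefl (splitAt m p) }

  module _ (R : Rooting T root) where
    open Rooting R

    jparent : Fin m ⊎ Fin m → Fin m ⊎ Fin m
    jparent (inj₁ a) = inj₁ (parent a)
    jparent (inj₂ b) with b ≟ root
    ... | yes _ = inj₁ root
    ... | no _ = inj₂ (parent b)

    jparent-root : jparent (inj₂ root) ≡ inj₁ root
    jparent-root with root ≟ root
    ... | yes _ = refl
    ... | no r≢ = ⊥-elim (r≢ refl)

    jparent-other : ∀ {b} → b ≢ root → jparent (inj₂ b) ≡ inj₂ (parent b)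
    jparent-other {b} b≢ with b ≟ root
    ... | yes b≡ = ⊥-elim (b≢ b≡)
    ... | no _ = refl

    -- The root of the second copy has the first root as its parent, so depths in the second copy
    -- are shifted past `depth root`.
    jdepth : Fin m ⊎ Fin m → ℕ
    jdepth (inj₁ a) = depth a
    jdepth (inj₂ b) = suc (depth root + depth b)

    jparent-adj : ∀ {p} → p ≢ inj₁ root → jadj p (jparent p) ≡ true
    jparent-adj {inj₁ a} p≢ = parent-adj (p≢ ∘ cong inj₁)
    jparent-adj {inj₂ b} p≢ with b ≟ root
    ... | no b≢ = parent-adj b≢
    ... | yes refl with root ≟ root
    ... | yes _ = refl
    ... | no r≢ = ⊥-elim (r≢ refl)

    jdepth-parent : ∀ {p} → p ≢ inj₁ root → jdepth (jparent p) < jdepth p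
    jdepth-parent {inj₁ a} p≢ = depth-parent (p≢ ∘ cong inj₁)
    jdepth-parent {inj₂ b} p≢ with b ≟ root
    ... | no b≢ = s≤s (+-monoʳ-< (depth root) (depth-parent b≢))
    ... | yes refl = s≤s (m≤m+n _ _)

    bridge : ∀ a b → jadj (inj₁ a) (inj₂ b) ≡ true → a ≡ root × b ≡ root
    bridge a b e with a ≟ root | b ≟ root
    ... | yes a≡ | yes b≡ = a≡ , b≡

    jadj-parent : ∀ p q → jadj p q ≡ true → (p ≢ inj₁ root × jparent p ≡ q) ⊎ (q ≢ inj₁ root × jparent q ≡ p)
    jadj-parent (inj₁ a) (inj₁ b) e with adj-parent e
    ... | inj₁ (a≢ , refl) = inj₁ ((λ { refl → a≢ refl }) , refl)
    ... | inj₂ (b≢ , refl) = inj₂ ((λ { refl → b≢ refl }) , refl)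
    jadj-parent (inj₁ a) (inj₂ b) e with bridge a b e
    ... | refl , refl = inj₂ ((λ ()) , jparent-root)
    jadj-parent (inj₂ a) (inj₁ b) e with bridge b a e
    ... | refl , refl = inj₁ ((λ ()) , jparent-root)
    jadj-parent (inj₂ a) (inj₂ b) e with adj-parent e
    ... | inj₁ (a≢ , refl) = inj₁ ((λ ()) , jparent-other a≢)
    ... | inj₂ (b≢ , refl) = inj₂ ((λ ()) , jparent-other b≢)

    split : Fin (m + m) → Fin m ⊎ Fin m
    split = splitAt m

    unsplit : Fin m ⊎ Fin m → Fin (m + m)
    unsplit = join m m

    split-unsplit : ∀ p → split (unsplit p) ≡ p
    split-unsplit = splitAt-join m m

    split-injective : ∀ {p q} → split p ≡ split q → p ≡ q
    split-injective {p} {q} e = trans (sym (join-splitAt m m p)) (trans (cong unsplit e) (join-splitAt m m q))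

    doubleRooting : Rooting double (unsplit (inj₁ root))
    doubleRooting = record
      { parent = unsplit ∘ jparent ∘ split
      ; depth = jdepth ∘ split
      ; parent-adj = λ {p} p≢ → trans (cong (jadj (split p)) (split-unsplit (jparent (split p)))) (jparent-adj (p≢ ∘ to-root))
      ; depth-parent = λ {p} p≢ → subst (λ q → jdepth q < jdepth (split p)) (sym (split-unsplit (jparent (split p)))) (jdepth-parent (p≢ ∘ to-root))
      ; adj-parent = λ {p} {q} e → [ (λ h → inj₁ (from h)) , (λ h → inj₂ (from h)) ]′ (jadj-parent (split p) (split q) e)
      }
      where
      to-root : ∀ {p} → split p ≡ inj₁ root → p ≡ unsplit (inj₁ root)
      to-root e = trans (sym (join-splitAt m m _)) (cong unsplit e)
      from : ∀ {p q} → split p ≢ inj₁ root × jparent (split p) ≡ split q →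
        p ≢ unsplit (inj₁ root) × unsplit (jparent (split p)) ≡ q
      from {q = q} (p≢ , e) = (λ { refl → p≢ (split-unsplit (inj₁ root)) }) , trans (cong unsplit e) (join-splitAt m m q)

    double-hasTop : ∀ {P : Fin m ⊎ Fin m → Set} top → P top →
      (∀ p → P p → p ≡ top ⊎ (p ≢ inj₁ root × P (jparent p))) → HasTop doubleRooting (P ∘ split)
    double-hasTop {P} top ptop up = unsplit top , subst P (sym (split-unsplit top)) ptop , λ {p} pp → lift p (up (split p) pp)
      where
      lift : ∀ p → split p ≡ top ⊎ (split p ≢ inj₁ root × P (jparent (split p))) →
        p ≡ unsplit top ⊎ (p ≢ unsplit (inj₁ root) × P (split (unsplit (jparent (split p)))))
      lift p (inj₁ e) = inj₁ (split-injective (trans e (sym (split-unsplit top))))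
      lift p (inj₂ (p≢ , pp)) = inj₂ ((λ { refl → p≢ (split-unsplit (inj₁ root)) }) , subst P (sym (split-unsplit _)) pp)

-- Fatness of a doubled tree

module _ {m : ℕ} (c c₁ c₂ : Fin m → ℕ) {x₀ : Fin m} where

  -- Bags smaller than the one at x₀ do not matter, since the fatness already drops at the size of that bag.
  SmallSplit : Fin m → Set
  SmallSplit x = (c₁ x < c x × c₂ x < c x) ⊎ (c₁ x ≤ c x × c₂ x < c x₀) ⊎ (c₂ x ≤ c x × c₁ x < c x₀)

  module _ (small : ∀ x → SmallSplit x) (c₁x₀<c : c₁ x₀ < c x₀) (c₂x₀<c : c₂ x₀ < c x₀) where

    private
      level : (Fin m → ℕ) → ℕ → Subset m
      level d i = compr (λ x → d x ℕₚ.≟ i)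

      ∈level : ∀ {d i x} → x ∈ level d i → d x ≡ i
      ∈level {d} {i} = ∈-compr⁻ (λ x → d x ℕₚ.≟ i)

      level∋ : ∀ {d i x} → d x ≡ i → x ∈ level d i
      level∋ {d} {i} = ∈-compr⁺ (λ x → d x ℕₚ.≟ i)

      -- The state forced on large bags while the two fatness vectors agree: one copy keeps the
      -- size, the other falls below the reference size `c x₀`.
      Tight : Fin m → Set
      Tight x = (c₁ x ≡ c x × c₂ x < c x₀) ⊎ (c₂ x ≡ c x × c₁ x < c x₀)

      module _ {i} (c₀≤i : c x₀ ≤ i) (tight : ∀ {x} → i < c x → Tight x) where

        -- A new bag of size `i` comes from an old bag of the same size: larger bags are tight and
        -- yield no size `i`, and smaller ones cannot grow to size `i`.
        level₁⇒ : ∀ {x} → c₁ x ≡ i → c x ≡ i × c₂ x < c x₀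
        level₁⇒ {x} e with <-cmp (c x) i
        ... | tri> _ _ i<c = ⊥-elim ([ (λ (e′ , _) → <⇒≢ i<c (trans (sym e) e′)) , (λ (_ , l) → <⇒≱ l (≤-trans c₀≤i (≤-reflexive (sym e)))) ]′ (tight i<c))
        ... | tri< c<i _ _ with small x
        ... | inj₁ (l , _) = ⊥-elim (<⇒≢ (<-trans l c<i) e)
        ... | inj₂ (inj₁ (l , _)) = ⊥-elim (<⇒≢ (≤-<-trans l c<i) e)
        ... | inj₂ (inj₂ (_ , l)) = ⊥-elim (<⇒≱ l (≤-trans c₀≤i (≤-reflexive (sym e))))
        level₁⇒ {x} e | tri≈ _ c≡i _ with small x
        ... | inj₁ (l , _) = ⊥-elim (<⇒≢ l (trans e (sym c≡i)))
        ... | inj₂ (inj₁ (_ , l)) = c≡i , l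
        ... | inj₂ (inj₂ (_ , l)) = ⊥-elim (<⇒≱ l (≤-trans c₀≤i (≤-reflexive (sym e))))

        level₂⇒ : ∀ {x} → c₂ x ≡ i → c x ≡ i × c₁ x < c x₀
        level₂⇒ {x} e with <-cmp (c x) i
        ... | tri> _ _ i<c = ⊥-elim ([ (λ (_ , l) → <⇒≱ l (≤-trans c₀≤i (≤-reflexive (sym e)))) , (λ (e′ , _) → <⇒≢ i<c (trans (sym e) e′)) ]′ (tight i<c))
        ... | tri< c<i _ _ with small x
        ... | inj₁ (_ , l) = ⊥-elim (<⇒≢ (<-trans l c<i) e)
        ... | inj₂ (inj₂ (l , _)) = ⊥-elim (<⇒≢ (≤-<-trans l c<i) e)
        ... | inj₂ (inj₁ (_ , l)) = ⊥-elim (<⇒≱ l (≤-trans c₀≤i (≤-reflexive (sym e))))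
        level₂⇒ {x} e | tri≈ _ c≡i _ with small x
        ... | inj₁ (_ , l) = ⊥-elim (<⇒≢ l (trans e (sym c≡i)))
        ... | inj₂ (inj₂ (_ , l)) = c≡i , l
        ... | inj₂ (inj₁ (_ , l)) = ⊥-elim (<⇒≱ l (≤-trans c₀≤i (≤-reflexive (sym e))))

        levels⊆ : level c₁ i ∪ level c₂ i ⊆ level c i
        levels⊆ x∈ = [ level∋ ∘ proj₁ ∘ level₁⇒ ∘ ∈level , level∋ ∘ proj₁ ∘ level₂⇒ ∘ ∈level ]′ (x∈p∪q⁻ (level c₁ i) _ x∈)

        levels≤ : ∣ level c₁ i ∣ + ∣ level c₂ i ∣ ≤ ∣ level c₁ i ∪ level c₂ i ∣
        levels≤ = disjoint⇒∣p∣+∣q∣≤∣p∪q∣ (level c₁ i) (level c₂ i)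
          (λ x∈₁ x∈₂ → <⇒≱ (proj₂ (level₁⇒ (∈level x∈₁))) (≤-trans c₀≤i (≤-reflexive (sym (∈level x∈₂)))))

        module _ (no-drop : ∣ level c i ∣ ≤ ∣ level c₁ i ∣ + ∣ level c₂ i ∣) where

          level⇒ : ∀ {x} → c x ≡ i → x ∈ level c₁ i ⊎ x ∈ level c₂ i
          level⇒ {x} e with x ∈? level c₁ i ∪ level c₂ i
          ... | yes x∈ = x∈p∪q⁻ (level c₁ i) _ x∈
          ... | no x∉ = ⊥-elim (<⇒≱ (p⊆q∧x⇒∣p∣<∣q∣ levels⊆ (level∋ e) x∉) (≤-trans no-drop levels≤))

          tight-at : ∀ {x} → i ≤ c x → Tight x
          tight-at i≤c with m≤n⇒m<n∨m≡n i≤c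
          ... | inj₁ i<c = tight i<c
          ... | inj₂ refl with level⇒ refl
          ... | inj₁ x∈ = inj₁ (∈level x∈ , proj₂ (level₁⇒ (∈level x∈)))
          ... | inj₂ x∈ = inj₂ (∈level x∈ , proj₂ (level₂⇒ (∈level x∈)))

          -- At the level `c x₀` the bag at `x₀` is lost, as both its copies are smaller; so the
          -- counts cannot agree there.
          c₀<i : c x₀ < i
          c₀<i with m≤n⇒m<n∨m≡n c₀≤i
          ... | inj₁ c₀<i = c₀<i
          ... | inj₂ e with level⇒ e
          ... | inj₁ x∈ = ⊥-elim (<⇒≢ c₁x₀<c (trans (∈level x∈) (sym e)))
          ... | inj₂ x∈ = ⊥-elim (<⇒≢ c₂x₀<c (trans (∈level x∈) (sym e)))

    -- Descent through the sizes: the new count never exceeds the old one, and equality makes the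
    -- level tight and leaves it above `c x₀`. The descent therefore cannot run out of levels
    -- without a strict drop.
    levels-not-≤lex : ∀ j → c x₀ < j → (∀ {x} → j ≤ c x → Tight x) →
      ¬ (map (λ i → ∣ level c i ∣) (downFrom j) ≤lex map (λ i → ∣ level c₁ i ∣ + ∣ level c₂ i ∣) (downFrom j))
    levels-not-≤lex (suc i) (s≤s c₀≤i) tight (inj₁ lt) = <-irrefl refl (c₀<i-level (<⇒≤ lt))
      where
      c₀<i-level : ∣ level c i ∣ ≤ ∣ level c₁ i ∣ + ∣ level c₂ i ∣ → _
      c₀<i-level h = ≤-<-trans (≤-trans (levels≤ c₀≤i tight) (p⊆q⇒∣p∣≤∣q∣ (levels⊆ c₀≤i tight))) lt
    levels-not-≤lex (suc i) (s≤s c₀≤i) tight (inj₂ (e , rest)) =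
      levels-not-≤lex i (c₀<i c₀≤i tight (≤-reflexive e)) (tight-at c₀≤i tight (≤-reflexive e)) rest

-- Tree decompositions over the doubled tree

record TreeSplit {n m : ℕ} (G : Graph n) {T : Graph m} {root : Fin m} (R : Rooting T root)
    (χ₁ χ₂ : Fin m → Subset n) (k : ℕ) : Set where
  open Rooting R
  field
    -- A vertex occurring in both copies must have bags reaching both roots, since the copies are
    -- joined only there.
    tops    : ∀ v →
      (HasTop R (λ x → v ∈ χ₁ x) × (∀ x → v ∉ χ₂ x)) ⊎
      (HasTop R (λ x → v ∈ χ₂ x) × (∀ x → v ∉ χ₁ x)) ⊎
      ((v ∈ χ₁ root × UpClosedTo R root (λ x → v ∈ χ₁ x)) × (v ∈ χ₂ root × UpClosedTo R root (λ x → v ∈ χ₂ x)))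
    edges   : ∀ {u v} → Adj G u v → ∃ λ x → (u ∈ χ₁ x × v ∈ χ₁ x) ⊎ (u ∈ χ₂ x × v ∈ χ₂ x)
    adh₁<   : ∀ {x} → x ≢ root → ∣ χ₁ x ∩ χ₁ (parent x) ∣ < k
    adh₂<   : ∀ {x} → x ≢ root → ∣ χ₂ x ∩ χ₂ (parent x) ∣ < k
    bridge< : ∣ χ₁ root ∩ χ₂ root ∣ < k

  bag : Fin m ⊎ Fin m → Subset n
  bag = [ χ₁ , χ₂ ]′

  private
    top : ∀ v → HasTop (doubleRooting T root R) (λ p → v ∈ bag (splitAt m p))
    top v with tops v
    ... | inj₁ ((t , v∈t , up) , v∉) = double-hasTop T root R {P = λ p → v ∈ bag p} (inj₁ t) v∈t λ
      { (inj₁ a) v∈a → [ (λ e → inj₁ (cong inj₁ e)) , (λ (a≢ , h) → inj₂ ((λ { refl → a≢ refl }) , h)) ]′ (up v∈a)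
      ; (inj₂ b) v∈b → ⊥-elim (v∉ b v∈b) }
    ... | inj₂ (inj₁ ((t , v∈t , up) , v∉)) = double-hasTop T root R {P = λ p → v ∈ bag p} (inj₂ t) v∈t λ
      { (inj₁ a) v∈a → ⊥-elim (v∉ a v∈a)
      ; (inj₂ b) v∈b → [ (λ e → inj₁ (cong inj₂ e))
                      , (λ (b≢ , h) → inj₂ ((λ ()) , subst (λ p → v ∈ bag p) (sym (jparent-other T root R b≢)) h)) ]′ (up v∈b) }
    ... | inj₂ (inj₂ ((v∈₁ , up₁) , (v∈₂ , up₂))) = double-hasTop T root R {P = λ p → v ∈ bag p} (inj₁ root) v∈₁ λ
      { (inj₁ a) v∈a → [ (λ e → inj₁ (cong inj₁ e)) , (λ (a≢ , h) → inj₂ ((λ { refl → a≢ refl }) , h)) ]′ (up₁ v∈a)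
      ; (inj₂ b) v∈b → inj₂ ((λ ()) , [ (λ { refl → subst (λ p → v ∈ bag p) (sym (jparent-root T root R)) v∈₁ })
                      , (λ (b≢ , h) → subst (λ p → v ∈ bag p) (sym (jparent-other T root R b≢)) h) ]′ (up₂ v∈b)) }

    edge : ∀ {u v} → Adj G u v → ∃ λ p → u ∈ bag (splitAt m p) × v ∈ bag (splitAt m p)
    edge {u} {v} e with edges e
    ... | x , inj₁ h = x ↑ˡ m , subst (λ p → u ∈ bag p × v ∈ bag p) (sym (splitAt-↑ˡ m x m)) h
    ... | x , inj₂ h = m ↑ʳ x , subst (λ p → u ∈ bag p × v ∈ bag p) (sym (splitAt-↑ʳ m m x)) h

  decomp : TreeDecomp G
  decomp = rootedDecomp (doubleRooting T root R) (bag ∘ splitAt m) top edge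

  adh-decomp : 0 < k → adh decomp < k
  adh-decomp 0<k = rooted-adh< decomp (doubleRooting T root R) 0<k λ {p} p≢ →
    subst (λ q → ∣ bag (splitAt m p) ∩ bag q ∣ < k) (sym (split-unsplit T root R (jparent T root R (splitAt m p))))
      (bound (splitAt m p) (λ e → p≢ (trans (sym (join-splitAt m m p)) (cong (join m m) e))))
    where
    bound : ∀ p → p ≢ inj₁ root → ∣ bag p ∩ bag (jparent T root R p) ∣ < k
    bound (inj₁ a) a≢ = adh₁< (a≢ ∘ cong inj₁)
    bound (inj₂ b) _ with b ≟ root
    ... | yes refl = ≤-<-trans (≤-reflexive (cong ∣_∣ (∩-comm (χ₂ b) (χ₁ b)))) bridge<
    ... | no b≢ = adh₂< b≢

  bagsOfSize-decomp : ∀ i → bagsOfSize decomp i ≡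
    ∣ compr (λ x → ∣ χ₁ x ∣ ℕₚ.≟ i) ∣ + ∣ compr (λ x → ∣ χ₂ x ∣ ℕₚ.≟ i) ∣
  bagsOfSize-decomp i = trans (∣compr∣-++ m (λ p → ∣ bag (splitAt m p) ∣ ℕₚ.≟ i))
    (cong₂ _+_ (cong ∣_∣ (tabulate-cong (λ x → cong (λ p → ⌊ ∣ bag p ∣ ℕₚ.≟ i ⌋) (splitAt-↑ˡ m x m))))
               (cong ∣_∣ (tabulate-cong (λ x → cong (λ p → ⌊ ∣ bag p ∣ ℕₚ.≟ i ⌋) (splitAt-↑ʳ m m x)))))

atomic⇒no-small-split : ∀ {n k} {G : Graph n} (D : TreeDecomp G) → IsAtomic k D →
  ∀ {root} {R : Rooting (T D) root} {χ₁ χ₂} → TreeSplit G R χ₁ χ₂ k → ∀ {x₀} →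
  (∀ x → SmallSplit (∣_∣ ∘ χ D) (∣_∣ ∘ χ₁) (∣_∣ ∘ χ₂) {x₀} x) →
  ∣ χ₁ x₀ ∣ < ∣ χ D x₀ ∣ → ∣ χ₂ x₀ ∣ < ∣ χ D x₀ ∣ → Empty.⊥
atomic⇒no-small-split {n} D (adh< , minimal) {χ₁ = χ₁} {χ₂} s {x₀} small x₁< x₂< =
  levels-not-≤lex (∣_∣ ∘ χ D) (∣_∣ ∘ χ₁) (∣_∣ ∘ χ₂) small x₁< x₂< (suc n) (s≤s (∣p∣≤n (χ D x₀)))
    -- No bag has more than `n` vertices, so tightness holds vacuously at the start.
    (λ {x} h → ⊥-elim (<⇒≱ h (∣p∣≤n (χ D x))))
    (subst (fatness D ≤lex_) (map-cong (TreeSplit.bagsOfSize-decomp s) (downFrom (suc n)))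
      (minimal (TreeSplit.decomp s) (TreeSplit.adh-decomp s (≤-<-trans z≤n adh<))))

-- Splitting a branch

flip-sep : ∀ {n} (G : Graph n) → Separation (Adj G) → Separation (Adj G)
flip-sep G s = record
  { left = right s ; right = left s ; cover = λ v → swap (cover s v) ; no-cross = λ e → swap (no-cross s (Adj-sym G e)) }

module _ {n : ℕ} (G : Graph n) (s : Separation (Adj G)) where

  ∉left⇒∈right : ∀ {v} → v ∉ left s → v ∈ right s
  ∉left⇒∈right {v} v∉ = [ (λ v∈ → ⊥-elim (v∉ v∈)) , id ]′ (cover s v)

  ∉right⇒∈left : ∀ {v} → v ∉ right s → v ∈ left s
  ∉right⇒∈left {v} v∉ = [ id , (λ v∈ → ⊥-elim (v∉ v∈)) ]′ (cover s v)

  -- The edge is used in both directions. If this puts one end on both sides, the other end decides.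
  edge-side : ∀ {u v} → Adj G u v → (u ∈ left s × v ∈ left s) ⊎ (u ∈ right s × v ∈ right s)
  edge-side {u} {v} e with no-cross s e | no-cross s (Adj-sym G e)
  ... | inj₁ u∈r | inj₁ v∈r = inj₂ (u∈r , v∈r)
  ... | inj₂ v∈l | inj₂ u∈l = inj₁ (u∈l , v∈l)
  ... | inj₁ u∈r | inj₂ u∈l = [ (λ v∈l → inj₁ (u∈l , v∈l)) , (λ v∈r → inj₂ (u∈r , v∈r)) ]′ (cover s v)
  ... | inj₂ v∈l | inj₁ v∈r = [ (λ u∈l → inj₁ (u∈l , v∈l)) , (λ u∈r → inj₂ (u∈r , v∈r)) ]′ (cover s u)

-- Bags in a rooted tree decomposition

module RootedAt {n : ℕ} {G : Graph n} (D : TreeDecomp G) {t : Fin (m D)} (R : Rooting (T D) t) where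
  open Rooting R public

  bags-hasTop : ∀ v → HasTop R (λ x → v ∈ χ D x)
  bags-hasTop v = connected⇒hasTop R (λ x → v ∈? χ D x) (coverV D v)
    λ {x} {y} v∈x v∈y → let p , w , all = connV D v x y v∈x v∈y in p , walk⇒chain w , All.lookup all

  top : Fin n → Fin (m D)
  top v = proj₁ (bags-hasTop v)

  top∈ : ∀ v → v ∈ χ D (top v)
  top∈ v = proj₁ (proj₂ (bags-hasTop v))

  top-up : ∀ {v x} → v ∈ χ D x → x ≡ top v ⊎ (x ≢ t × v ∈ χ D (parent x))
  top-up {v} = proj₂ (proj₂ (bags-hasTop v))

  ≡⇒⊑ : ∀ {x y} → x ≡ y → x ⊑ y
  ≡⇒⊑ refl = ⊑-refl

  top-⊑ : ∀ {v} x → v ∈ χ D x → top v ⊑ x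
  top-⊑ {v} = upward-rec (λ x → v ∈ χ D x → top v ⊑ x) at-root up
    where
    at-root : v ∈ χ D t → top v ⊑ t
    at-root v∈ with top-up v∈
    ... | inj₁ t≡ = ≡⇒⊑ (sym t≡)
    ... | inj₂ (t≢ , _) = ⊥-elim (t≢ refl)
    up : ∀ {x} → x ≢ t → (v ∈ χ D (parent x) → top v ⊑ parent x) → v ∈ χ D x → top v ⊑ x
    up x≢ ih v∈ with top-up v∈
    ... | inj₁ x≡ = ≡⇒⊑ (sym x≡)
    ... | inj₂ (_ , v∈p) = ⊑-step x≢ (ih v∈p)

  -- Going up from `y`, the vertex `v` stays in the bags until its top; this either carries it to
  -- `x` or stops at a top inside the branch at `x`.
  climb : ∀ {v x y} → x ⊑ y → v ∈ χ D y → v ∈ χ D x ⊎ x ⊑ top v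
  climb ⊑-refl v∈ = inj₁ v∈
  climb (⊑-step y≢ p) v∈ with top-up v∈
  ... | inj₁ refl = inj₂ (⊑-step y≢ p)
  ... | inj₂ (_ , v∈p) = climb p v∈p

  ⊑root⇒≡ : ∀ {x} → x ⊑ t → x ≡ t
  ⊑root⇒≡ ⊑-refl = refl
  ⊑root⇒≡ (⊑-step t≢ _) = ⊥-elim (t≢ refl)

  ∈root⇒top≡root : ∀ {v} → v ∈ χ D t → top v ≡ t
  ∈root⇒top≡root v∈ = ⊑root⇒≡ (top-⊑ t v∈)

  ⊑top∧∈root⇒≡root : ∀ {x v} → x ⊑ top v → v ∈ χ D t → x ≡ t
  ⊑top∧∈root⇒≡root x⊑ v∈ = ⊑root⇒≡ (subst (_ ⊑_) (∈root⇒top≡root v∈) x⊑)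

  adhesion : Fin (m D) → Subset n
  adhesion x = χ D x ∩ χ D (parent x)

  adhesion< : ∀ {k x} → adh D < k → x ≢ t → ∣ adhesion x ∣ < k
  adhesion< adh<k x≢ = ≤-<-trans (adhesion≤adh D ≤-refl (parent-adj x≢)) adh<k

  -- Branches at different children of the root are disjoint, so a separator vertex accounts for at
  -- most one branch.
  child-unique : ∀ {x x′ y} → x ≢ t → parent x ≡ t → x′ ≢ t → parent x′ ≡ t → x ⊑ y → x′ ⊑ y → x ≡ x′
  child-unique x≢ px x′≢ px′ ⊑-refl ⊑-refl = refl
  child-unique x≢ px x′≢ px′ ⊑-refl (⊑-step _ q) = ⊥-elim (x′≢ (⊑root⇒≡ (subst (_ ⊑_) px q)))
  child-unique x≢ px x′≢ px′ (⊑-step _ p) ⊑-refl = ⊥-elim (x≢ (⊑root⇒≡ (subst (_ ⊑_) px′ p)))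
  child-unique x≢ px x′≢ px′ (⊑-step _ p) (⊑-step _ q) = child-unique x≢ px x′≢ px′ p q

-- If no vertex of the separator lies properly inside the branch at s, the branch can be replaced by
-- two copies of itself hanging off t, one for each side of the separation.
module Branch {n k : ℕ} {G : Graph n} (D : TreeDecomp G) (atomic : IsAtomic k D) {t : Fin (m D)} (R : Rooting (T D) t)
  (sep : Separation (Adj G)) where
  open RootedAt D R

  module _ {s : Fin (m D)} (s≢t : s ≢ t) (ps≡t : parent s ≡ t) {u w : Fin n}
    (u∈s : u ∈ χ D s) (w∈s : w ∈ χ D s) (u∉r : u ∉ right sep) (w∉l : w ∉ left sep)
    (none : ∀ {x} → x ∈ left sep → x ∈ right sep → ¬ s ⊑ top x) where

    private
      -- The first copy keeps every bag outside the branch at `s` and the right part inside it. The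
      -- second carries the left part of the branch, and at `t` only the left part of the adhesion
      -- set of `s`; its other bags are empty.
      P₁ P₂ : Fin (m D) → Fin n → Set
      P₁ x v = v ∈ χ D x × (s ⊑ x → v ∈ right sep)
      P₂ x v = v ∈ left sep × ((s ⊑ x × v ∈ χ D x) ⊎ (x ≡ t × v ∈ χ D s × v ∈ χ D t))

      P₁? : ∀ x → Decidable (P₁ x)
      P₁? x v = (v ∈? χ D x) ×-dec ((s ⊑? x) →-dec (v ∈? right sep))

      P₂? : ∀ x → Decidable (P₂ x)
      P₂? x v = (v ∈? left sep) ×-dec (((s ⊑? x) ×-dec (v ∈? χ D x)) ⊎-dec ((x ≟ t) ×-dec ((v ∈? χ D s) ×-dec (v ∈? χ D t))))

      χ₁ χ₂ : Fin (m D) → Subset n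
      χ₁ x = compr (P₁? x)
      χ₂ x = compr (P₂? x)

      χ₁⁺ : ∀ {x v} → P₁ x v → v ∈ χ₁ x
      χ₁⁺ = ∈-compr⁺ (P₁? _)
      χ₁⁻ : ∀ {x v} → v ∈ χ₁ x → P₁ x v
      χ₁⁻ = ∈-compr⁻ (P₁? _)
      χ₂⁺ : ∀ {x v} → P₂ x v → v ∈ χ₂ x
      χ₂⁺ = ∈-compr⁺ (P₂? _)
      χ₂⁻ : ∀ {x v} → v ∈ χ₂ x → P₂ x v
      χ₂⁻ = ∈-compr⁻ (P₂? _)

      ¬s⊑t : ¬ s ⊑ t
      ¬s⊑t = s≢t ∘ ⊑root⇒≡

      unchanged : ∀ {v} → (∀ {x} → v ∈ χ D x → s ⊑ x → v ∈ right sep) → HasTop R (λ x → v ∈ χ₁ x)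
      unchanged {v} h = top v , χ₁⁺ (top∈ v , h (top∈ v)) ,
        λ v∈ → [ inj₁ , (λ (x≢ , v∈p) → inj₂ (x≢ , χ₁⁺ (v∈p , h v∈p))) ]′ (top-up (proj₁ (χ₁⁻ v∈)))

      tops : ∀ v →
        (HasTop R (λ x → v ∈ χ₁ x) × (∀ x → v ∉ χ₂ x)) ⊎
        (HasTop R (λ x → v ∈ χ₂ x) × (∀ x → v ∉ χ₁ x)) ⊎
        ((v ∈ χ₁ t × UpClosedTo R t (λ x → v ∈ χ₁ x)) × (v ∈ χ₂ t × UpClosedTo R t (λ x → v ∈ χ₂ x)))
      tops v with v ∈? left sep | s ⊑? top v | v ∈? χ D s
      ... | no v∉l | _ | _ = inj₁ (unchanged (λ _ _ → ∉left⇒∈right G sep v∉l) , λ x → v∉l ∘ proj₁ ∘ χ₂⁻)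
      -- All bags of `v` lie in the branch, and by `none` it is not on the right, so it moves
      -- entirely to the second copy.
      ... | yes v∈l | yes s⊑ | _ = inj₂ (inj₁ ((top v , χ₂⁺ (v∈l , inj₁ (s⊑ , top∈ v)) , up) , λ x v∈ →
          let v∈x , h = χ₁⁻ v∈ in none v∈l (h (⊑-trans s⊑ (top-⊑ x v∈x))) s⊑))
        where
        up : UpClosedTo R (top v) (λ x → v ∈ χ₂ x)
        up {x} v∈ with χ₂⁻ v∈
        ... | _ , inj₂ (_ , _ , v∈t) = ⊥-elim (s≢t (⊑top∧∈root⇒≡root s⊑ v∈t))
        ... | _ , inj₁ (_ , v∈x) with top-up v∈x
        ... | inj₁ e = inj₁ e
        ... | inj₂ (x≢ , v∈p) = inj₂ (x≢ , χ₂⁺ (v∈l , inj₁ (⊑-trans s⊑ (top-⊑ _ v∈p) , v∈p)))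
      ... | yes v∈l | no ¬s⊑ | no v∉s = inj₁ (unchanged (λ v∈x s⊑x → ⊥-elim (not-in-branch s⊑x v∈x)) , λ x → none₂ ∘ χ₂⁻)
        where
        not-in-branch : ∀ {x} → s ⊑ x → ¬ v ∈ χ D x
        not-in-branch s⊑x v∈x = [ v∉s , ¬s⊑ ]′ (climb s⊑x v∈x)
        none₂ : ∀ {x} → ¬ P₂ x v
        none₂ (_ , inj₁ (s⊑x , v∈x)) = not-in-branch s⊑x v∈x
        none₂ (_ , inj₂ (_ , v∈s , _)) = v∉s v∈s
      -- The bags of `v` continue above `s`, so `v` lies in the bag at `t` and passes between the
      -- copies through the two roots.
      ... | yes v∈l | no ¬s⊑ | yes v∈s =
        inj₂ (inj₂ ((χ₁⁺ (v∈t , ⊥-elim ∘ ¬s⊑t) , up₁) , (χ₂⁺ (v∈l , inj₂ (refl , v∈s , v∈t)) , up₂)))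
        where
        v∈t : v ∈ χ D t
        v∈t with top-up v∈s
        ... | inj₁ s≡ = ⊥-elim (¬s⊑ (≡⇒⊑ s≡))
        ... | inj₂ (_ , v∈p) = subst (λ x → v ∈ χ D x) ps≡t v∈p
        up₁ : UpClosedTo R t (λ x → v ∈ χ₁ x)
        up₁ {x} v∈ with χ₁⁻ v∈
        ... | v∈x , h with top-up v∈x
        ... | inj₁ e = inj₁ (trans e (∈root⇒top≡root v∈t))
        ... | inj₂ (x≢ , v∈p) = inj₂ (x≢ , χ₁⁺ (v∈p , λ s⊑p → h (⊑-step x≢ s⊑p)))
        up₂ : UpClosedTo R t (λ x → v ∈ χ₂ x)
        up₂ {x} v∈ with χ₂⁻ v∈
        ... | _ , inj₂ (e , _) = inj₁ e
        ... | _ , inj₁ (⊑-refl , _) = inj₂ (s≢t , χ₂⁺ (v∈l , inj₂ (ps≡t , v∈s , v∈t)))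
        ... | _ , inj₁ (⊑-step x≢ s⊑p , v∈x) with top-up v∈x
        ... | inj₁ refl = ⊥-elim (¬s⊑ (⊑-step x≢ s⊑p))
        ... | inj₂ (_ , v∈p) = inj₂ (x≢ , χ₂⁺ (v∈l , inj₁ (s⊑p , v∈p)))

      edges : ∀ {a b} → Adj G a b → ∃ λ x → (a ∈ χ₁ x × b ∈ χ₁ x) ⊎ (a ∈ χ₂ x × b ∈ χ₂ x)
      edges {a} {b} e with coverE D a b e
      ... | x , a∈ , b∈ with toSum (s ⊑? x) | edge-side G sep e
      ... | inj₂ ¬s⊑x | _ = x , inj₁ (χ₁⁺ (a∈ , ⊥-elim ∘ ¬s⊑x) , χ₁⁺ (b∈ , ⊥-elim ∘ ¬s⊑x))
      ... | inj₁ s⊑x | inj₁ (al , bl) = x , inj₂ (χ₂⁺ (al , inj₁ (s⊑x , a∈)) , χ₂⁺ (bl , inj₁ (s⊑x , b∈)))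
      ... | inj₁ s⊑x | inj₂ (ar , br) = x , inj₁ (χ₁⁺ (a∈ , λ _ → ar) , χ₁⁺ (b∈ , λ _ → br))

      χ₁⊆ : ∀ {x} → χ₁ x ⊆ χ D x
      χ₁⊆ = proj₁ ∘ χ₁⁻

      χ₂⊆s : ∀ {x} → ¬ s ⊑ x → χ₂ x ⊆ χ D s
      χ₂⊆s ¬s⊑x v∈ with χ₂⁻ v∈
      ... | _ , inj₁ (s⊑x , _) = ⊥-elim (¬s⊑x s⊑x)
      ... | _ , inj₂ (_ , v∈s , _) = v∈s

      χ₂⊆ : ∀ {x} → x ≢ t → χ₂ x ⊆ χ D x
      χ₂⊆ x≢ v∈ with χ₂⁻ v∈
      ... | _ , inj₁ (_ , v∈x) = v∈x
      ... | _ , inj₂ (x≡t , _) = ⊥-elim (x≢ x≡t)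

      χ₂⊆parent : ∀ {x} → x ≢ t → χ₂ (parent x) ⊆ χ D (parent x)
      χ₂⊆parent x≢ v∈ with χ₂⁻ v∈
      ... | _ , inj₁ (_ , v∈x) = v∈x
      ... | _ , inj₂ (p≡t , _ , v∈t) = subst (λ y → _ ∈ χ D y) (sym p≡t) v∈t

      branchSplit : TreeSplit G R χ₁ χ₂ k
      branchSplit = record
        { tops = tops
        ; edges = edges
        ; adh₁< = λ {x} x≢ → ≤-<-trans (p⊆q⇒∣p∣≤∣q∣ λ v∈ →
            let a , b = x∈p∩q⁻ (χ₁ x) _ v∈ in x∈p∩q⁺ (χ₁⊆ a , χ₁⊆ b)) (adhesion< (proj₁ atomic) x≢)
        ; adh₂< = λ {x} x≢ → ≤-<-trans (p⊆q⇒∣p∣≤∣q∣ λ v∈ →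
            let a , b = x∈p∩q⁻ (χ₂ x) _ v∈ in x∈p∩q⁺ (χ₂⊆ x≢ a , χ₂⊆parent x≢ b)) (adhesion< (proj₁ atomic) x≢)
        ; bridge< = ≤-<-trans (p⊆q⇒∣p∣≤∣q∣ λ v∈ →
            let a , b = x∈p∩q⁻ (χ₁ t) _ v∈ in x∈p∩q⁺ (χ₂⊆s ¬s⊑t b , subst (λ y → _ ∈ χ D y) (sym ps≡t) (χ₁⊆ a)))
            (adhesion< (proj₁ atomic) s≢t)
        }

      w∉χ₂ : ∀ {x} → w ∉ χ₂ x
      w∉χ₂ = w∉l ∘ proj₁ ∘ χ₂⁻

      in-s : ∀ {x v} → s ⊑ x → v ∈ χ D x → v ∈ left sep → v ∈ right sep → v ∈ χ D s
      in-s s⊑x v∈x v∈l v∈r = [ id , ⊥-elim ∘ none v∈l v∈r ]′ (climb s⊑x v∈x)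

      -- The reference bag is that of `s`. Inside the branch, a bag with vertices missing from each
      -- side shrinks in both copies. A bag contained in one side leaves for the other copy only
      -- separator vertices; these lie in the bag at `s` and omit `u` or `w`.
      small : ∀ x → SmallSplit (∣_∣ ∘ χ D) (∣_∣ ∘ χ₁) (∣_∣ ∘ χ₂) {s} x
      small x with toSum (s ⊑? x)
      ... | inj₂ ¬s⊑x = inj₂ (inj₁ (p⊆q⇒∣p∣≤∣q∣ χ₁⊆ , p⊆q∧x⇒∣p∣<∣q∣ (χ₂⊆s ¬s⊑x) w∈s w∉χ₂))
      ... | inj₁ s⊑x with any? (λ z → (z ∈? χ D x) ×-dec ¬? (z ∈? left sep)) | any? (λ z → (z ∈? χ D x) ×-dec ¬? (z ∈? right sep))
      ... | yes (a , a∈ , a∉l) | yes (b , b∈ , b∉r) = inj₁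
        ( p⊆q∧x⇒∣p∣<∣q∣ χ₁⊆ b∈ (λ b∈₁ → b∉r (proj₂ (χ₁⁻ b∈₁) s⊑x))
        , p⊆q∧x⇒∣p∣<∣q∣ (χ₂⊆ λ { refl → ¬s⊑t s⊑x }) a∈ (a∉l ∘ proj₁ ∘ χ₂⁻))
      ... | no all-l | _ = inj₂ (inj₂
        ( p⊆q⇒∣p∣≤∣q∣ (χ₂⊆ λ { refl → ¬s⊑t s⊑x })
        , p⊆q∧x⇒∣p∣<∣q∣ (λ {v} v∈ → let v∈x , h = χ₁⁻ v∈ in
              in-s s⊑x v∈x (decidable-stable (v ∈? left sep) (λ v∉ → all-l (v , v∈x , v∉))) (h s⊑x))
            u∈s (λ u∈ → u∉r (proj₂ (χ₁⁻ u∈) s⊑x))))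
      ... | yes _ | no all-r = inj₂ (inj₁
        ( p⊆q⇒∣p∣≤∣q∣ χ₁⊆
        , p⊆q∧x⇒∣p∣<∣q∣ (λ {v} v∈ → let v∈x = χ₂⊆ (λ { refl → ¬s⊑t s⊑x }) v∈ in
              in-s s⊑x v∈x (proj₁ (χ₂⁻ v∈)) (decidable-stable (v ∈? right sep) (λ v∉ → all-r (v , v∈x , v∉))))
            w∈s w∉χ₂))

    impossible : Empty.⊥
    impossible = atomic⇒no-small-split D atomic branchSplit small
      (p⊆q∧x⇒∣p∣<∣q∣ χ₁⊆ u∈s (λ u∈ → u∉r (proj₂ (χ₁⁻ u∈) ⊑-refl)))
      (p⊆q∧x⇒∣p∣<∣q∣ (χ₂⊆ s≢t) w∈s w∉χ₂)

  separator-meets-branch : ∀ {s u w} → s ≢ t → parent s ≡ t → u ∈ χ D s → w ∈ χ D s →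
    u ∉ right sep → w ∉ left sep → ∃ λ x → x ∈ separator sep × s ⊑ top x
  separator-meets-branch {s} s≢ ps u∈ w∈ u∉ w∉ with any? (λ x → (x ∈? separator sep) ×-dec (s ⊑? top x))
  ... | yes h = h
  ... | no ¬h = ⊥-elim (impossible s≢ ps u∈ w∈ u∉ w∉ (λ l r s⊑ → ¬h (_ , x∈p∩q⁺ (l , r) , s⊑)))

-- Balanced separations

module _ {n : ℕ} {z y w c : Subset n} (z⊆ : ∀ {v} → v ∈ z → (v ∈ y × v ∈ c) ⊎ v ∈ w)
  (w-small : Nonempty w → ∣ w ∣ < ∣ y ─ c ∣) where

  -- At most `y ∩ c` survives from `y`, and the added `w` is smaller than the lost `y ─ c`.
  exchange-< : Nonempty w → ∣ z ∣ < ∣ y ∣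
  exchange-< ne = ≤-<-trans (⊆∪⇒∣p∣≤ (λ v∈ → [ inj₁ ∘ x∈p∩q⁺ , inj₂ ]′ (z⊆ v∈)))
    (<-≤-trans (+-monoʳ-< ∣ y ∩ c ∣ (w-small ne)) (≤-reflexive (sym (∣p∣≡∣p∩q∣+∣p─q∣ y c))))

  exchange-≤ : ∣ z ∣ ≤ ∣ y ∣
  exchange-≤ with nonempty? w
  ... | yes ne = <⇒≤ (exchange-< ne)
  ... | no ¬ne = p⊆q⇒∣p∣≤∣q∣ (λ v∈ → [ proj₁ , (λ h → ⊥-elim (¬ne (_ , h))) ]′ (z⊆ v∈))

module Lean {n k : ℕ} {G : Graph n} (D : TreeDecomp G) (atomic : IsAtomic k D) {t : Fin (m D)} (R : Rooting (T D) t) where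
  open RootedAt D R

  topDepth : Fin n → ℕ
  topDepth = depth ∘ top

  record Balanced (s : Separation (Adj G)) : Set where
    field
      order<     : ∣ separator s ∣ < k
      left-large  : k ≤ ∣ left s ∩ χ D t ∣
      right-large : k ≤ ∣ right s ∩ χ D t ∣
  open Balanced

  Minimal : Separation (Adj G) → Set
  Minimal s = ∀ s′ → Balanced s′ → ¬ weight topDepth (separator s′) < weight topDepth (separator s)

  flip-balanced : ∀ {s} → Balanced s → Balanced (flip-sep G s)
  flip-balanced {s} b = record
    { order< = subst (λ X → ∣ X ∣ < k) (∩-comm (left s) (right s)) (order< b)
    ; left-large = right-large b ; right-large = left-large b }

  flip-minimal : ∀ {s} → Minimal s → Minimal (flip-sep G s)
  flip-minimal {s} min s′ b′ lt = min s′ b′ (subst (λ X → weight topDepth (separator s′) < weight topDepth X) (∩-comm (right s) (left s)) lt)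

  module _ {s : Separation (Adj G)} (balanced : Balanced s) (minimal : Minimal s) where

    module _ {P S : Subset n} {c : ℕ}
      (boundary : ∀ {a b} → Adj G a b → a ∈ P → b ∈ P ⊎ b ∈ S)
      (root∩P : ∀ {v} → v ∈ χ D t → v ∉ P)
      (S-shallow : ∀ {v} → v ∈ S → topDepth v ≤ c) (P-deep : ∀ {v} → v ∈ P → c < topDepth v) where

      private
        -- The region `P` moves to the left side together with its frontier `S`, so the separator
        -- loses its part in `P` and gains only `S ─ left s`.
        shifted : Separation (Adj G)
        shifted = record { left = left s ∪ (P ∪ S) ; right = right s ─ P ; cover = cov ; no-cross = nc }
          where
          cov : ∀ v → v ∈ left s ∪ (P ∪ S) ⊎ v ∈ right s ─ P
          cov v with v ∈? P | cover s v
          ... | yes v∈P | _ = inj₁ (x∈p∪q⁺ (inj₂ (x∈p∪q⁺ (inj₁ v∈P))))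
          ... | no _ | inj₁ v∈l = inj₁ (x∈p∪q⁺ (inj₁ v∈l))
          ... | no v∉P | inj₂ v∈r = inj₂ (x∈p∧x∉q⇒x∈p─q v∈r v∉P)
          nc : ∀ {a b} → Adj G a b → a ∈ right s ─ P ⊎ b ∈ left s ∪ (P ∪ S)
          nc {a} e with a ∈? P | no-cross s e
          ... | yes a∈P | _ = inj₂ (x∈p∪q⁺ (inj₂ (x∈p∪q⁺ (boundary e a∈P))))
          ... | no _ | inj₂ b∈l = inj₂ (x∈p∪q⁺ (inj₁ b∈l))
          ... | no a∉P | inj₁ a∈r = inj₁ (x∈p∧x∉q⇒x∈p─q a∈r a∉P)

        shifted-separator : ∀ {v} → v ∈ separator shifted → v ∈ separator s ─ P ⊎ v ∈ S ─ left s
        shifted-separator {v} v∈ with x∈p∩q⁻ (left shifted) _ v∈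
        ... | v∈l′ , v∈r′ with x∈p─q⁻ (right s) P v∈r′ | v ∈? left s
        ... | v∈r , v∉P | yes v∈l = inj₁ (x∈p∧x∉q⇒x∈p─q (x∈p∩q⁺ (v∈l , v∈r)) v∉P)
        ... | v∈r , v∉P | no v∉l with x∈p∪q⁻ (left s) _ v∈l′
        ... | inj₁ v∈l = ⊥-elim (v∉l v∈l)
        ... | inj₂ v∈PS with x∈p∪q⁻ P S v∈PS
        ... | inj₁ v∈P = ⊥-elim (v∉P v∈P)
        ... | inj₂ v∈S = inj₂ (x∈p∧x∉q⇒x∈p─q v∈S v∉l)

        shifted-balanced : ∣ S ─ left s ∣ ≤ ∣ separator s ∩ P ∣ → Balanced shifted
        shifted-balanced ≤P = record
          { order< = ≤-<-trans (⊆∪⇒∣p∣≤ shifted-separator) (≤-<-trans (+-monoʳ-≤ ∣ separator s ─ P ∣ ≤P)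
              (≤-<-trans (≤-reflexive (trans (+-comm ∣ separator s ─ P ∣ _) (sym (∣p∣≡∣p∩q∣+∣p─q∣ (separator s) P)))) (order< balanced)))
          ; left-large = ≤-trans (left-large balanced) (p⊆q⇒∣p∣≤∣q∣ λ v∈ →
              let a , b = x∈p∩q⁻ (left s) _ v∈ in x∈p∩q⁺ (x∈p∪q⁺ (inj₁ a) , b))
          ; right-large = ≤-trans (right-large balanced) (p⊆q⇒∣p∣≤∣q∣ λ v∈ →
              let a , b = x∈p∩q⁻ (right s) _ v∈ in x∈p∩q⁺ (x∈p∧x∉q⇒x∈p─q a (root∩P b) , b))
          }

      -- Otherwise shifting would trade deep separator vertices for at most as many shallower ones.
      -- The result stays balanced because `P` avoids the bag at `t`, contradicting minimality.
      minimal⇒∣separator∩P∣< : Nonempty (separator s ∩ P) → ∣ separator s ∩ P ∣ < ∣ S ─ left s ∣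
      minimal⇒∣separator∩P∣< ne = ≰⇒> λ ≤P → minimal shifted (shifted-balanced ≤P)
        (weight-exchange topDepth {p = separator shifted} shifted-separator ≤P ne
          (S-shallow ∘ proj₁ ∘ x∈p─q⁻ S (left s)) P-deep)

    strictlyBelow? : ∀ x → Decidable (λ v → x ⊑ top v × v ∉ χ D x)
    strictlyBelow? x v = (x ⊑? top v) ×-dec ¬? (v ∈? χ D x)

    strictlyBelow : Fin (m D) → Subset n
    strictlyBelow x = compr (strictlyBelow? x)

    below : Fin (m D) → Subset n
    below x = compr (λ v → x ⊑? top v)

    neighbour-below : ∀ {x a b} → x ⊑ top a → Adj G a b → b ∈ χ D x ⊎ x ⊑ top b
    neighbour-below {a = a} {b} x⊑ e with coverE D a b e
    ... | y , a∈ , b∈ = climb (⊑-trans x⊑ (top-⊑ y a∈)) b∈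

    -- The region consists of the vertices whose bags all lie properly below `x`; the bag at `x` is
    -- its frontier.
    bag-exchange : ∀ x → Nonempty (separator s ∩ strictlyBelow x) → ∣ separator s ∩ strictlyBelow x ∣ < ∣ χ D x ─ left s ∣
    bag-exchange x = minimal⇒∣separator∩P∣<
      (λ {a} {b} e a∈ → boundary (neighbour-below (proj₁ (∈-compr⁻ (strictlyBelow? x) a∈)) e))
      (λ v∈t v∈ → let x⊑ , v∉ = ∈-compr⁻ (strictlyBelow? x) v∈ in
        v∉ (subst (λ y → _ ∈ χ D y) (sym (⊑top∧∈root⇒≡root x⊑ v∈t)) v∈t))
      (λ v∈ → ⊑⇒depth≤ (top-⊑ x v∈))
      (λ {v} v∈ → let x⊑ , v∉ = ∈-compr⁻ (strictlyBelow? x) v∈ in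
        ⊑∧≢⇒depth< x⊑ (λ x≡ → v∉ (subst (λ y → v ∈ χ D y) (sym x≡) (top∈ v))))
      where
      boundary : ∀ {b} → b ∈ χ D x ⊎ x ⊑ top b → b ∈ strictlyBelow x ⊎ b ∈ χ D x
      boundary {b} h with b ∈? χ D x | h
      ... | yes b∈ | _ = inj₂ b∈
      ... | no b∉ | inj₁ b∈ = ⊥-elim (b∉ b∈)
      ... | no b∉ | inj₂ x⊑ = inj₁ (∈-compr⁺ (strictlyBelow? x) (x⊑ , b∉))

    -- Here vertices with top `x` belong to the region as well, so the adhesion set is the frontier
    -- and `depth (parent x)` separates the depths.
    adhesion-exchange : ∀ {x} → x ≢ t → Nonempty (separator s ∩ below x) → ∣ separator s ∩ below x ∣ < ∣ adhesion x ─ left s ∣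
    adhesion-exchange {x} x≢ = minimal⇒∣separator∩P∣<
      (λ e a∈ → boundary (neighbour-below (∈-compr⁻ (λ v → x ⊑? top v) a∈) e))
      (λ v∈t v∈ → x≢ (⊑top∧∈root⇒≡root (∈-compr⁻ (λ v → x ⊑? top v) v∈) v∈t))
      (λ v∈ → ⊑⇒depth≤ (top-⊑ (parent x) (proj₂ (x∈p∩q⁻ (χ D x) _ v∈))))
      (λ v∈ → <-≤-trans (depth-parent x≢) (⊑⇒depth≤ (∈-compr⁻ (λ v → x ⊑? top v) v∈)))
      where
      boundary : ∀ {b} → b ∈ χ D x ⊎ x ⊑ top b → b ∈ below x ⊎ b ∈ adhesion x
      boundary (inj₂ x⊑) = inj₁ (∈-compr⁺ (λ v → x ⊑? top v) x⊑)
      boundary (inj₁ b∈) with top-up b∈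
      ... | inj₁ x≡ = inj₁ (∈-compr⁺ (λ v → x ⊑? top v) (≡⇒⊑ x≡))
      ... | inj₂ (_ , b∈p) = inj₂ (x∈p∩q⁺ (b∈ , b∈p))

    -- Adding separator vertices on the way from their tops to the root puts the whole separator
    -- into the root bags of both copies, where the copies are joined.
    SideBag : Fin (m D) → Fin n → Set
    SideBag x v = (v ∈ χ D x × v ∈ left s) ⊎ ((v ∈ left s × v ∈ right s) × x ⊑ top v)

    sideBag? : ∀ x → Decidable (SideBag x)
    sideBag? x v = ((v ∈? χ D x) ×-dec (v ∈? left s)) ⊎-dec (((v ∈? left s) ×-dec (v ∈? right s)) ×-dec (x ⊑? top v))

    sideBag : Fin (m D) → Subset n
    sideBag x = compr (sideBag? x)

    sideBag⁻ : ∀ {x v} → v ∈ sideBag x → SideBag x v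
    sideBag⁻ {x} = ∈-compr⁻ (sideBag? x)

    sideBag⁺ : ∀ {x v} → SideBag x v → v ∈ sideBag x
    sideBag⁺ {x} = ∈-compr⁺ (sideBag? x)

    sideBag⊆left : ∀ {x} → sideBag x ⊆ left s
    sideBag⊆left v∈ = [ proj₂ , proj₁ ∘ proj₁ ]′ (sideBag⁻ v∈)

    sideBag⊆ : ∀ {x v} → v ∈ sideBag x → (v ∈ χ D x × v ∈ left s) ⊎ v ∈ separator s ∩ strictlyBelow x
    sideBag⊆ {x} {v} v∈ with sideBag⁻ v∈ | v ∈? χ D x
    ... | inj₁ h | _ = inj₁ h
    ... | inj₂ (lr , x⊑) | yes v∈x = inj₁ (v∈x , proj₁ lr)
    ... | inj₂ (lr , x⊑) | no v∉x = inj₂ (x∈p∩q⁺ (x∈p∩q⁺ lr , ∈-compr⁺ (strictlyBelow? x) (x⊑ , v∉x)))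

    sideBag-≤ : ∀ x → ∣ sideBag x ∣ ≤ ∣ χ D x ∣
    sideBag-≤ x = exchange-≤ {c = left s} sideBag⊆ (bag-exchange x)

    sideBag-< : ∀ x → Nonempty (separator s ∩ strictlyBelow x) → ∣ sideBag x ∣ < ∣ χ D x ∣
    sideBag-< x = exchange-< {c = left s} sideBag⊆ (bag-exchange x)

    sideBag⊆bag : ∀ {x} → ¬ Nonempty (separator s ∩ strictlyBelow x) → sideBag x ⊆ χ D x
    sideBag⊆bag ¬ne v∈ = [ proj₁ , (λ h → ⊥-elim (¬ne (_ , h))) ]′ (sideBag⊆ v∈)

    -- If vertices were added from below, the exchange already makes the bag smaller; if not, the
    -- bag only loses vertices, among them `v`.
    sideBag-missing : ∀ {x v} → v ∈ χ D x → v ∉ left s → ∣ sideBag x ∣ < ∣ χ D x ∣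
    sideBag-missing {x} v∈ v∉ with nonempty? (separator s ∩ strictlyBelow x)
    ... | yes ne = sideBag-< x ne
    ... | no ¬ne = p⊆q∧x⇒∣p∣<∣q∣ (sideBag⊆bag ¬ne) v∈ (v∉ ∘ sideBag⊆left)

    sideBag-adhesion : ∀ {x} → x ≢ t → ∣ sideBag x ∩ sideBag (parent x) ∣ < k
    sideBag-adhesion {x} x≢ = ≤-<-trans (exchange-≤ {c = left s} common (adhesion-exchange x≢)) (adhesion< (proj₁ atomic) x≢)
      where
      ∈below : ∀ {v} → (v ∈ left s × v ∈ right s) → x ⊑ top v → v ∈ separator s ∩ below x
      ∈below lr x⊑ = x∈p∩q⁺ (x∈p∩q⁺ lr , ∈-compr⁺ (λ v → x ⊑? top v) x⊑)
      common : ∀ {v} → v ∈ sideBag x ∩ sideBag (parent x) → (v ∈ adhesion x × v ∈ left s) ⊎ v ∈ separator s ∩ below x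
      common {v} v∈ with x∈p∩q⁻ (sideBag x) _ v∈
      ... | a , b with sideBag⁻ a | sideBag⁻ b
      ... | inj₂ (lr , x⊑) | _ = inj₂ (∈below lr x⊑)
      ... | inj₁ (v∈x , v∈l) | inj₁ (v∈p , _) = inj₁ (x∈p∩q⁺ (v∈x , v∈p) , v∈l)
      -- Even if `v` was added to the bag at the parent, its presence at `x` means that either its
      -- top is `x` or it was in the parent bag originally.
      ... | inj₁ (v∈x , v∈l) | inj₂ (lr , _) with top-up v∈x
      ... | inj₁ x≡ = inj₂ (∈below lr (≡⇒⊑ x≡))
      ... | inj₂ (_ , v∈p) = inj₁ (x∈p∩q⁺ (v∈x , v∈p) , v∈l)

    sideBag-hasTop : ∀ {v} → v ∉ right s → HasTop R (λ x → v ∈ sideBag x)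
    sideBag-hasTop {v} v∉r = top v , sideBag⁺ (inj₁ (top∈ v , v∈l)) , up
      where
      v∈l = ∉right⇒∈left G s v∉r
      up : UpClosedTo R (top v) (λ x → v ∈ sideBag x)
      up v∈ with sideBag⁻ v∈
      ... | inj₂ ((_ , v∈r) , _) = ⊥-elim (v∉r v∈r)
      ... | inj₁ (v∈x , _) = [ inj₁ , (λ (x≢ , v∈p) → inj₂ (x≢ , sideBag⁺ (inj₁ (v∈p , v∈l)))) ]′ (top-up v∈x)

    sideBag-root : ∀ {v} → v ∈ left s → v ∈ right s →
      v ∈ sideBag t × UpClosedTo R t (λ x → v ∈ sideBag x)
    sideBag-root {v} v∈l v∈r = sideBag⁺ (inj₂ ((v∈l , v∈r) , root-⊑ (top v))) , up
      where
      up : UpClosedTo R t (λ x → v ∈ sideBag x)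
      up {x} v∈ with x ≟ t | sideBag⁻ v∈
      ... | yes x≡t | _ = inj₁ x≡t
      ... | no x≢ | inj₂ (lr , x⊑) = inj₂ (x≢ , sideBag⁺ (inj₂ (lr , ⊑-trans (parent-⊑ x≢) x⊑)))
      ... | no x≢ | inj₁ (v∈x , _) with top-up v∈x
      ... | inj₁ x≡ = inj₂ (x≢ , sideBag⁺ (inj₂ ((v∈l , v∈r) , ⊑-trans (parent-⊑ x≢) (≡⇒⊑ x≡))))
      ... | inj₂ (_ , v∈p) = inj₂ (x≢ , sideBag⁺ (inj₁ (v∈p , v∈l)))

    -- Otherwise the at least `k` vertices of the root bag on the right would all lie in the
    -- separator.
    leaves-left : ∃ λ v → v ∈ χ D t × v ∉ left s
    leaves-left with any? (λ v → (v ∈? χ D t) ×-dec ¬? (v ∈? left s))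
    ... | yes h = h
    ... | no ¬h = ⊥-elim (<⇒≱ (order< balanced) (≤-trans (right-large balanced) (p⊆q⇒∣p∣≤∣q∣ λ {v} v∈ →
      let v∈r , v∈t = x∈p∩q⁻ (right s) _ v∈ in
      x∈p∩q⁺ (decidable-stable (v ∈? left s) (λ v∉ → ¬h (v , v∈t , v∉)) , v∈r))))

  minimal⇒unbalanced : ∀ {s} → Minimal s → ¬ Balanced s
  minimal⇒unbalanced {s} min bal = atomic⇒no-small-split D atomic leanSplit small
    (let _ , v∈ , v∉ = leaves-left bal min in sideBag-missing bal min v∈ v∉)
    (let _ , v∈ , v∉ = leaves-left bal′ min′ in sideBag-missing bal′ min′ v∈ v∉)
    where
    bal′ = flip-balanced bal
    min′ : Minimal (flip-sep G s)
    min′ = flip-minimal {s} min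
    χ₁ χ₂ : Fin (m D) → Subset n
    χ₁ = sideBag bal min
    χ₂ = sideBag bal′ min′
    tops : ∀ v →
      (HasTop R (λ x → v ∈ χ₁ x) × (∀ x → v ∉ χ₂ x)) ⊎
      (HasTop R (λ x → v ∈ χ₂ x) × (∀ x → v ∉ χ₁ x)) ⊎
      ((v ∈ χ₁ t × UpClosedTo R t (λ x → v ∈ χ₁ x)) × (v ∈ χ₂ t × UpClosedTo R t (λ x → v ∈ χ₂ x)))
    tops v with v ∈? left s | v ∈? right s
    ... | _ | no v∉r = inj₁ (sideBag-hasTop bal min v∉r , λ x → v∉r ∘ sideBag⊆left bal′ min′)
    ... | no v∉l | yes _ = inj₂ (inj₁ (sideBag-hasTop bal′ min′ v∉l , λ x → v∉l ∘ sideBag⊆left bal min))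
    ... | yes v∈l | yes v∈r = inj₂ (inj₂ (sideBag-root bal min v∈l v∈r , sideBag-root bal′ min′ v∈r v∈l))
    edges : ∀ {a b} → Adj G a b → ∃ λ x → (a ∈ χ₁ x × b ∈ χ₁ x) ⊎ (a ∈ χ₂ x × b ∈ χ₂ x)
    edges {a} {b} e with coverE D a b e | edge-side G s e
    ... | x , a∈ , b∈ | inj₁ (al , bl) = x , inj₁ (sideBag⁺ bal min (inj₁ (a∈ , al)) , sideBag⁺ bal min (inj₁ (b∈ , bl)))
    ... | x , a∈ , b∈ | inj₂ (ar , br) = x , inj₂ (sideBag⁺ bal′ min′ (inj₁ (a∈ , ar)) , sideBag⁺ bal′ min′ (inj₁ (b∈ , br)))
    leanSplit : TreeSplit G R χ₁ χ₂ k
    leanSplit = record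
      { tops = tops
      ; edges = edges
      ; adh₁< = sideBag-adhesion bal min
      ; adh₂< = sideBag-adhesion bal′ min′
      ; bridge< = ≤-<-trans (p⊆q⇒∣p∣≤∣q∣ λ v∈ → let a , b = x∈p∩q⁻ (χ₁ t) _ v∈ in
          x∈p∩q⁺ (sideBag⊆left bal min a , sideBag⊆left bal′ min′ b)) (order< bal)
      }
    separator<root : ∣ separator s ∣ < ∣ χ D t ∣
    separator<root = <-≤-trans (order< bal) (≤-trans (left-large bal) (∣p∩q∣≤∣q∣ (left s) (χ D t)))
    small : ∀ x → SmallSplit (∣_∣ ∘ χ D) (∣_∣ ∘ χ₁) (∣_∣ ∘ χ₂) {t} x
    small x with any? (λ z → (z ∈? χ D x) ×-dec ¬? (z ∈? left s)) | any? (λ z → (z ∈? χ D x) ×-dec ¬? (z ∈? right s))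
    ... | yes (a , a∈ , a∉l) | yes (b , b∈ , b∉r) = inj₁ (sideBag-missing bal min a∈ a∉l , sideBag-missing bal′ min′ b∈ b∉r)
    -- If the bag lies in the left side, its right copy lies in the separator, which is smaller than
    -- the reference bag at `t`.
    ... | no all-l | _ = inj₂ (inj₁ (sideBag-≤ bal min x , ≤-<-trans (p⊆q⇒∣p∣≤∣q∣ χ₂⊆) separator<root))
      where
      χ₂⊆ : χ₂ x ⊆ separator s
      χ₂⊆ {v} v∈ with sideBag⁻ bal′ min′ v∈
      ... | inj₁ (v∈x , v∈r) = x∈p∩q⁺ (decidable-stable (v ∈? left s) (λ v∉ → all-l (v , v∈x , v∉)) , v∈r)
      ... | inj₂ ((v∈r , v∈l) , _) = x∈p∩q⁺ (v∈l , v∈r)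
    ... | yes _ | no all-r = inj₂ (inj₂ (sideBag-≤ bal′ min′ x , ≤-<-trans (p⊆q⇒∣p∣≤∣q∣ χ₁⊆) separator<root))
      where
      χ₁⊆ : χ₁ x ⊆ separator s
      χ₁⊆ {v} v∈ with sideBag⁻ bal min v∈
      ... | inj₁ (v∈x , v∈l) = x∈p∩q⁺ (v∈l , decidable-stable (v ∈? right s) (λ v∉ → all-r (v , v∈x , v∉)))
      ... | inj₂ (lr , _) = x∈p∩q⁺ lr

  -- Well-founded induction on the weight: once all lighter separations are known to be unbalanced,
  -- `s` is minimal.
  unbalanced : ∀ s → ¬ Balanced s
  unbalanced s = aux s (<-wellFounded _)
    where
    aux : ∀ s → Acc _<_ (weight topDepth (separator s)) → ¬ Balanced s
    aux s (acc rec) = minimal⇒unbalanced (λ s′ b′ lt → aux s′ (rec lt) b′)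

-- Torso degrees

isYes⁻ : ∀ {A : Set} (d : Dec A) → isYes d ≡ true → A
isYes⁻ (yes a) _ = a

not-isYes⁻ : ∀ {A : Set} (d : Dec A) → not (isYes d) ≡ true → ¬ A
not-isYes⁻ (no ¬a) _ = ¬a

∧-true⁻ : ∀ {a b} → a ∧ b ≡ true → a ≡ true × b ≡ true
∧-true⁻ {true} {true} _ = refl , refl

∨-true⁻ : ∀ {a b} → a ∨ b ≡ true → a ≡ true ⊎ b ≡ true
∨-true⁻ {true} _ = inj₁ refl
∨-true⁻ {false} e = inj₂ e

foldr-∨⁻ : ∀ {A : Set} (f : A → Bool) (xs : List A) → foldr _∨_ false (map f xs) ≡ true → ∃ λ x → f x ≡ true
foldr-∨⁻ f (x ∷ xs) e with ∨-true⁻ {f x} e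
... | inj₁ h = x , h
... | inj₂ h = foldr-∨⁻ f xs h

torsoAdj⁻ : ∀ {n} {G : Graph n} (D : TreeDecomp G) {t u w} → torsoAdj D t u w ≡ true →
  w ∈ χ D t × u ≢ w × (Adj G u w ⊎ ∃ λ y → Adj (T D) t y × u ∈ χ D y × w ∈ χ D y)
torsoAdj⁻ D {t} {u} {w} e =
  let _ , e₁ = ∧-true⁻ {isYes (u ∈? χ D t)} e ; w∈ , e₂ = ∧-true⁻ {isYes (w ∈? χ D t)} e₁ ; u≢w , e₃ = ∧-true⁻ e₂
  in isYes⁻ (w ∈? χ D t) w∈ , not-isYes⁻ (u ≟ w) u≢w ,
     [ inj₁ , (λ e₄ → inj₂ (common (foldr-∨⁻ _ (allFin (m D)) e₄))) ]′ (∨-true⁻ e₃)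
  where
  common : (∃ λ y → adj (T D) t y ∧ ⌊ u ∈? χ D y ⌋ ∧ ⌊ w ∈? χ D y ⌋ ≡ true) →
    ∃ λ y → Adj (T D) t y × u ∈ χ D y × w ∈ χ D y
  common (y , h) = let ty , h₁ = ∧-true⁻ h ; u∈ , w∈ = ∧-true⁻ {isYes (u ∈? χ D y)} h₁ in
    y , ty , isYes⁻ (u ∈? χ D y) u∈ , isYes⁻ (w ∈? χ D y) w∈

-- For `k = j + 3` the common factor is positive, and `k < 2k - 2` holds since `k > 2`.
k*[k-2]<[2k-2]*[k-2] : ∀ {k} → 3 ≤ k → k * (k ∸ 2) < (2 * k ∸ 2) * (k ∸ 2)
k*[k-2]<[2k-2]*[k-2] {suc (suc (suc j))} _ = *-monoˡ-< (suc j) (≤-trans (s≤s (≤-reflexive (sym (+-identityʳ (3 + j))))) (s≤s (m≤n+m _ j)))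
k*[k-2]<[2k-2]*[k-2] {suc zero} (s≤s ())
k*[k-2]<[2k-2]*[k-2] {suc (suc zero)} (s≤s (s≤s ()))

module _ {n k : ℕ} {G : Graph n} (D : TreeDecomp G) (atomic : IsAtomic k D) {t : Fin (m D)} (R : Rooting (T D) t) where
  open RootedAt D R

  torsoDeg≤ : ∀ (s : Separation (Adj G)) {u} → u ∈ χ D t → u ∉ right s →
    ∣ separator s ∣ < k → ∣ left s ∩ χ D t ∣ < k → torsoDeg D t u ≤ k * (k ∸ 2)
  torsoDeg≤ s {u} u∈t u∉r ∣s∣<k ∣l∣<k = ≤-trans (⊆∪⇒∣p∣≤ {q = near} {r = bigUnion (separator s) far} nbr)
    -- `near` and one set per separator vertex make at most `k` sets of size at most `k ∸ 2`.
    (≤-trans (+-mono-≤ ∣near∣≤ (∣bigUnion∣≤ (separator s) far ∣far∣≤)) (*-monoˡ-≤ (k ∸ 2) ∣s∣<k))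
    where
    ∣p-u∣≤ : ∀ {p} → u ∈ p → ∣ p ∣ < k → ∣ p - u ∣ ≤ k ∸ 2
    ∣p-u∣≤ u∈ <k = ∸-monoˡ-≤ 2 (≤-trans (s≤s (x∈p⇒∣p-x∣<∣p∣ u∈)) <k)

    near : Subset n
    near = (left s ∩ χ D t) - u

    ∣near∣≤ : ∣ near ∣ ≤ k ∸ 2
    ∣near∣≤ = ∣p-u∣≤ (x∈p∩q⁺ (∉right⇒∈left G s u∉r , u∈t)) ∣l∣<k

    BranchOf : Fin n → Fin (m D) → Set
    BranchOf x y = y ≢ t × parent y ≡ t × y ⊑ top x × u ∈ χ D y

    branchOf? : ∀ x → Decidable (BranchOf x)
    branchOf? x y = ¬? (y ≟ t) ×-dec ((parent y ≟ t) ×-dec ((y ⊑? top x) ×-dec (u ∈? χ D y)))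

    -- The candidate neighbours in the branch containing the top of `x`, if `u` lies in the bag at
    -- that child; `⊥` is the default. Uniqueness of the child makes the choice harmless.
    far : Fin n → Subset n
    far x with any? (branchOf? x)
    ... | yes (y , _) = adhesion y - u
    ... | no _ = ⊥

    ∣far∣≤ : ∀ x → ∣ far x ∣ ≤ k ∸ 2
    ∣far∣≤ x with any? (branchOf? x)
    ... | yes (y , y≢ , py , _ , u∈y) = ∣p-u∣≤ (x∈p∩q⁺ (u∈y , subst (λ z → u ∈ χ D z) (sym py) u∈t)) (adhesion< (proj₁ atomic) y≢)
    ... | no _ = ≤-trans (≤-reflexive (∣⊥∣≡0 n)) z≤n

    far∋ : ∀ {x y w} → BranchOf x y → w ∈ adhesion y → w ≢ u → w ∈ far x
    far∋ {x} b@(y≢ , py , y⊑ , _) w∈ w≢u with any? (branchOf? x)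
    ... | no ¬b = ⊥-elim (¬b (_ , b))
    ... | yes (y′ , y′≢ , py′ , y′⊑ , _) =
      x∈p∧x≢y⇒x∈p-y (subst (λ z → _ ∈ adhesion z) (child-unique y≢ py y′≢ py′ y⊑ y′⊑) w∈) w≢u

    nbr : ∀ {w} → w ∈ tabulate (torsoAdj D t u) → w ∈ near ⊎ w ∈ bigUnion (separator s) far
    nbr {w} w∈N with torsoAdj⁻ D {t} {u} {w} (trans (sym (lookup∘tabulate (torsoAdj D t u) w)) ([]=⇒lookup w∈N)) | w ∈? left s
    ... | w∈t , u≢w , _ | yes w∈l = inj₁ (x∈p∧x≢y⇒x∈p-y (x∈p∩q⁺ (w∈l , w∈t)) (u≢w ∘ sym))
    -- An edge of `G` from `u` cannot end outside the left side, since `u` is not on the right.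
    ... | _ , _ , inj₁ uw | no w∉l = ⊥-elim ([ u∉r , w∉l ]′ (no-cross s uw))
    ... | w∈t , u≢w , inj₂ (y , ty , u∈y , w∈y) | no w∉l with adj-parent ty
    ... | inj₁ (t≢ , _) = ⊥-elim (t≢ refl)
    ... | inj₂ (y≢ , py) with Branch.separator-meets-branch D atomic R s y≢ py u∈y w∈y u∉r w∉l
    ... | x , x∈s , y⊑ = inj₂ (∈-bigUnion⁺ far x∈s
      (far∋ (y≢ , py , y⊑ , u∈y) (x∈p∩q⁺ (w∈y , subst (λ z → w ∈ χ D z) (sym py) w∈t)) (u≢w ∘ sym)))

theorem2p12 : ∀ {n : ℕ} (G : Graph n) (k : ℕ) → 3 ≤ k →
    (D : TreeDecomp G) → IsAtomic k D →
    (t : Fin (m D)) (u v : Fin n) → u ∈ χ D t → v ∈ χ D t →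
    u ≢ v → adj G u v ≡ false →
    (2 * k ∸ 2) * (k ∸ 2) ≤ torsoDeg D t u →
    (2 * k ∸ 2) * (k ∸ 2) ≤ torsoDeg D t v →
    DisjointPaths G k u v
theorem2p12 G k 3≤k D atomic t u v u∈t v∈t u≢v u≁v deg-u deg-v with menger-vertices G k u v u≢v u≁v
... | inj₁ paths = paths
... | inj₂ (s , u∉r , v∉l , ∣s∣<k) with k ≤? ∣ left s ∩ χ D t ∣ | k ≤? ∣ right s ∩ χ D t ∣
... | yes l | yes r = ⊥-elim (Lean.unbalanced D atomic R s (record { order< = ∣s∣<k ; left-large = l ; right-large = r }))
  where R = isTree⇒rooting (T D) (isTree D) t
... | no l | _ = ⊥-elim (<⇒≱ (k*[k-2]<[2k-2]*[k-2] 3≤k) (≤-trans deg-u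
  (torsoDeg≤ D atomic (isTree⇒rooting (T D) (isTree D) t) s u∈t u∉r ∣s∣<k (≰⇒> l))))
-- The same count for `v`, with the sides exchanged.
... | yes _ | no r = ⊥-elim (<⇒≱ (k*[k-2]<[2k-2]*[k-2] 3≤k) (≤-trans deg-v
  (torsoDeg≤ D atomic (isTree⇒rooting (T D) (isTree D) t) (flip-sep G s) v∈t v∉l
    (subst (λ X → ∣ X ∣ < k) (∩-comm (left s) (right s)) ∣s∣<k) (≰⇒> r))))
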